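{- Let $T$ be a tournament. Then either the profile $\varphi_T$ is bounded from above by a polynomial, in which case $T$ is a lexicographical sum of acyclic tournaments indexed by a finite tournament; or the growth of $\varphi_T$ is at least exponential, i.e. there are reals $a>0$, $c>1$ with $\varphi_T(n)\ge a c^n$.
   Context: A tournament is a set with an irreflexive, antisymmetric, complete binary relation; acyclic means no $3$-cycle (the edge relation is a strict linear order). The profile $\varphi_T(n)$ is the number of tournaments induced by $T$ on the $n$-element subsets of $V(T)$, counted up to isomorphism. Lexicographical sum $\sum_{i\in D}T_i$: vertex set the disjoint union of the $V(T_i)$, with $(x,i)\to(y,j)$ iff ($i=j$ and $x\to y$ in $T_i$) or $i\to j$ in $D$. -}

module Defs where

open import Level using (0ℓ) renaming (suc to lsuc)
open import Data.Nat using (ℕ; zero; suc; _+_; _*_; _^_; _≤_; _<_)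
open import Data.Fin using (Fin)
open import Data.Product using (Σ; ∃; _×_; _,_)
open import Data.Sum using (_⊎_)
open import Data.Empty using (⊥)
open import Relation.Nullary using (¬_)
open import Relation.Binary.PropositionalEquality using (_≡_; _≢_)
open import Function.Bundles using (_⤖_; _⇔_; Bijection)
open import Function.Definitions using (Injective)

record IsTournament {V : Set} (R : V → V → Set) : Set where
  field
    irrefl   : ∀ x → ¬ R x x
    antisym  : ∀ x y → R x y → ¬ R y x
    complete : ∀ x y → x ≢ y → R x y ⊎ R y x

record Tournament : Set₁ where
  field
    V            : Set
    _⇒_          : V → V → Set
    isTournament : IsTournament _⇒_
open Tournament public

FinTour : ℕ → Set₁
FinTour n = Σ (Fin n → Fin n → Set) IsTournament

Iso : {A B : Set} → (A → A → Set) → (B → B → Set) → Set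
Iso {A} {B} R S = Σ (A ⤖ B) λ f →
  ∀ x y → R x y ⇔ S (Bijection.to f x) (Bijection.to f y)

Embeds : {n : ℕ} → FinTour n → Tournament → Set
Embeds {n} (S , _) T = Σ (Fin n → V T) λ g →
  Injective _≡_ _≡_ g × (∀ i j → S i j ⇔ _⇒_ T (g i) (g j))

Induced : (T : Tournament) {n : ℕ} → (Fin n → V T) → Fin n → Fin n → Set
Induced T g i j = _⇒_ T (g i) (g j)

ProfileAtLeast : Tournament → ℕ → ℕ → Set₁
ProfileAtLeast T n k = Σ (Fin k → FinTour n) λ S →
  (∀ m → Embeds (S m) T) ×
  (∀ m m' → m ≢ m' → ¬ Iso (Σ.proj₁ (S m)) (Σ.proj₁ (S m')))
  where open import Data.Product as Σ using ()

ProfileAtMost : Tournament → ℕ → ℕ → Set₁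
ProfileAtMost T n k = Σ (Fin k → FinTour n) λ S →
  ∀ (g : Fin n → V T) → Injective _≡_ _≡_ g →
    ∃ λ m → Iso (Σ.proj₁ (S m)) (Induced T g)
  where open import Data.Product as Σ using ()

PolyBounded : Tournament → Set₁
PolyBounded T = Σ ℕ λ C → Σ ℕ λ d → ∀ n → ProfileAtMost T n (C * (suc n) ^ d)

-- φ_T grows at least exponentially: φ_T(n) ≥ a c^n for all n, with
-- a = r/s > 0 and c = p/q > 1 (positive rationals).
ExpGrowth : Tournament → Set₁
ExpGrowth T = Σ ℕ λ p → Σ ℕ λ q → Σ ℕ λ r → Σ ℕ λ s →
  (1 ≤ q) × (q < p) × (1 ≤ r) × (1 ≤ s) ×
  (∀ n → Σ ℕ λ k → (r * p ^ n ≤ s * q ^ n * k) × ProfileAtLeast T n k)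

Acyclic : Tournament → Set
Acyclic T = ∀ x y z → ¬ (_⇒_ T x y × _⇒_ T y z × _⇒_ T z x)

data LexRel {d : ℕ} (D : Fin d → Fin d → Set) (Ts : Fin d → Tournament)
     : Σ (Fin d) (λ i → V (Ts i)) → Σ (Fin d) (λ i → V (Ts i)) → Set where
  inside : ∀ {i x y} → _⇒_ (Ts i) x y → LexRel D Ts (i , x) (i , y)
  across : ∀ {i j x y} → D i j → LexRel D Ts (i , x) (j , y)

LexSumOfAcyclic : Tournament → Set₁
LexSumOfAcyclic T = Σ ℕ λ d → Σ (FinTour d) λ D → Σ (Fin d → Tournament) λ Ts →
  (∀ i → Acyclic (Ts i)) × Iso (_⇒_ T) (LexRel (Data.Product.proj₁ D) Ts)
  where import Data.Product

{-# OPTIONS --safe #-}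
-- Call x and y equivalent if some acyclic module (autonomous set) contains both. Acyclic modules that meet have an
-- acyclic module as their union, so T is the lexicographical sum of its equivalence classes, which are acyclic. If
-- they are finitely many, a finite subtournament is determined up to isomorphism by the sizes of its blocks, and the
-- profile is polynomial.
--
-- Otherwise take pairwise inequivalent v 0, v 1, …, by Ramsey increasing (up to reversing T). As x = v (2 i) and
-- y = v (2 i + 1) are inequivalent, a 3-cycle p → q → r → p has p and q in the interval [x , y]. By Ramsey the arcs
-- between the i-th and the j-th of these quintuples, i < j, do not depend on i and j. Unless subtournaments code
-- binary words, p and q, and then r, are interleaved with x and y into one chain, so that the 3-cycles themselves
-- form a chain; and chains of 3-cycles and points do code binary words.
--
-- A code with one marked vertex suffices for exponential growth: n + 1 vertices can be marked in n + 1 ways only.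
module Submission where

open import Defs
open import Level using (Lift; lift; lower) renaming (suc to lsuc; zero to lzero)
open import Data.Bool using (Bool; true; false)
open import Data.Nat using (ℕ; zero; suc; _+_; _*_; _^_; _≤_; _<_; z≤n; s≤s)
open import Data.Nat.Properties
open import Data.Nat.Tactic.RingSolver using (solve-∀)
open import Data.Fin using (Fin; zero; suc; toℕ)
import Data.Fin as F
import Data.Fin.Properties as FP
open import Data.Fin.Subset using (Subset; _∈_; ∣_∣)
open import Data.Fin.Subset.Properties using (p⊂q⇒∣p∣<∣q∣; ∣⊤∣≡n; ∈⊤)
open import Data.Vec using (tabulate)
open import Data.Vec.Properties using (lookup⇒[]=; []=⇒lookup; lookup∘tabulate)
open import Data.Product using (Σ; _×_; _,_; proj₁; proj₂)
open import Data.Sum as Sum using (_⊎_; inj₁; inj₂; [_,_])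
open import Data.Empty using (⊥; ⊥-elim)
open import Relation.Nullary using (¬_; Dec; yes; no)
open import Relation.Nullary.Decidable using (map′; does; dec-true)
open import Relation.Binary using (tri<; tri≈; tri>)
open import Relation.Binary.PropositionalEquality using (_≡_; _≢_; refl; sym; trans; cong; cong₂; subst; subst₂)
open import Function using (_∘_; id)
open import Function.Bundles using (_⇔_; mk⇔; mk↔ₛ′; Bijection; Inverse; Equivalence)
open import Function.Definitions using (Injective)
open import Function.Properties.Bijection using (⤖⇒↔)
open import Function.Properties.Inverse using (↔⇒⤖)
open import Axiom.ExcludedMiddle using (ExcludedMiddle)

-- Isomorphisms with explicit inverses

record _≃_ {A B : Set} (R : A → A → Set) (S : B → B → Set) : Set where
  field
    to      : A → B
    from    : B → A
    from-to : ∀ x → from (to x) ≡ x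
    to-from : ∀ y → to (from y) ≡ y
    arc     : ∀ {x y} → R x y → S (to x) (to y)
    arc⁻    : ∀ {x y} → S (to x) (to y) → R x y
  to-injective : Injective _≡_ _≡_ to
  to-injective {x} {y} e = trans (sym (from-to x)) (trans (cong from e) (from-to y))

open _≃_

module _ {A B : Set} {R : A → A → Set} {S : B → B → Set} where

  Iso⇒≃ : Iso R S → R ≃ S
  Iso⇒≃ (f , h) = record
    { to      = Bijection.to f
    ; from    = Inverse.from (⤖⇒↔ f)
    ; from-to = λ x → Inverse.strictlyInverseʳ (⤖⇒↔ f) x
    ; to-from = λ y → Inverse.strictlyInverseˡ (⤖⇒↔ f) y
    ; arc     = λ {x} {y} → Equivalence.to (h x y)
    ; arc⁻    = λ {x} {y} → Equivalence.from (h x y)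
    }

  ≃⇒Iso : R ≃ S → Iso R S
  ≃⇒Iso e = ↔⇒⤖ (mk↔ₛ′ (to e) (from e) (to-from e) (from-to e)) , λ x y → mk⇔ (arc e) (arc⁻ e)

  ≃-sym : R ≃ S → S ≃ R
  ≃-sym e = record
    { to = from e ; from = to e ; from-to = to-from e ; to-from = from-to e
    ; arc  = λ {x} {y} s → arc⁻ e (subst₂ S (sym (to-from e x)) (sym (to-from e y)) s)
    ; arc⁻ = λ {x} {y} r → subst₂ S (to-from e x) (to-from e y) (arc e r)
    }

≃-refl : {A : Set} {R : A → A → Set} → R ≃ R
≃-refl = record
  { to = id ; from = id ; from-to = λ _ → refl ; to-from = λ _ → refl ; arc = id ; arc⁻ = id }

≃-trans : {A B C : Set} {R : A → A → Set} {S : B → B → Set} {U : C → C → Set} →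
          R ≃ S → S ≃ U → R ≃ U
≃-trans e e′ = record
  { to = to e′ ∘ to e ; from = from e ∘ from e′
  ; from-to = λ x → trans (cong (from e) (from-to e′ (to e x))) (from-to e x)
  ; to-from = λ y → trans (cong (to e′) (to-from e (from e′ y))) (to-from e′ y)
  ; arc = arc e′ ∘ arc e ; arc⁻ = arc⁻ e ∘ arc⁻ e′
  }

-- The infinite Ramsey theorem

Increasing : (ℕ → ℕ) → Set
Increasing t = ∀ {i j} → i < j → t i < t j

step⇒increasing : (t : ℕ → ℕ) → (∀ i → t i < t (suc i)) → Increasing t
step⇒increasing t st {i} {suc j} i<1+j with m<1+n⇒m<n∨m≡n i<1+j
... | inj₁ i<j = <-trans (step⇒increasing t st i<j) (st j)
... | inj₂ refl = st i

Uniform : (ℕ → ℕ → Set) → Set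
Uniform A = ∀ i j → i < j → A i j

_at_ : (ℕ → ℕ → Set) → (ℕ → ℕ) → ℕ → ℕ → Set
(A at t) i j = A (t i) (t j)

restrict : {A : ℕ → ℕ → Set} {t : ℕ → ℕ} → Increasing t → Uniform A → Uniform (A at t)
restrict t↑ h i j i<j = h _ _ (t↑ i<j)

module Classical (em : ExcludedMiddle (lsuc lzero)) where

  dec : (P : Set) → Dec P
  dec P = map′ lower lift (em {Lift (lsuc lzero) P})

  -- If `B` holds from some index N on, shifting by N will do. Otherwise there are indices with `A`
  -- beyond every bound, and `next` collects them.
  pigeon : {A B : ℕ → Set} → (∀ i → A i ⊎ B i) →
           Σ (ℕ → ℕ) λ t → Increasing t × ((∀ k → A (t k)) ⊎ (∀ k → B (t k)))
  pigeon {A} {B} e with dec (Σ ℕ λ N → ∀ n → N ≤ n → B n)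
  ... | yes (N , h) = (N +_) , +-monoʳ-< N , inj₂ (λ k → h _ (m≤m+n N k))
  ... | no ¬h = t , step⇒increasing t (λ i → proj₁ (proj₂ (next (suc (t i))))) , inj₁ tA
    where
    next : ∀ N → Σ ℕ λ n → N ≤ n × A n
    next N with dec (Σ ℕ λ n → N ≤ n × A n)
    ... | yes r = r
    ... | no ¬r = ⊥-elim (¬h (N , λ n N≤n → [ (λ a → ⊥-elim (¬r (n , N≤n , a))) , id ] (e n)))
    t : ℕ → ℕ
    t zero    = proj₁ (next 0)
    t (suc k) = proj₁ (next (suc (t k)))
    tA : ∀ k → A (t k)
    tA zero    = proj₂ (proj₂ (next 0))
    tA (suc k) = proj₂ (proj₂ (next (suc (t k))))

  -- The stages are nested infinite subsequences. The first term of each is set aside as `a k`, and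
  -- the rest is thinned until `a k` has one colour with all that remains.
  module Thinning {A B : ℕ → ℕ → Set} (e : Uniform (λ i j → A i j ⊎ B i j)) where
    thin : ((s , _) : Σ (ℕ → ℕ) Increasing) →
           Σ (ℕ → ℕ) λ t → Increasing t × ((∀ k → A (s 0) (s (suc (t k)))) ⊎ (∀ k → B (s 0) (s (suc (t k)))))
    thin (s , s↑) = pigeon (λ k → e _ _ (s↑ {0} {suc k} (s≤s z≤n)))
    stage : ℕ → Σ (ℕ → ℕ) Increasing
    stage zero    = id , id
    stage (suc k) = let (s , s↑) = stage k ; (t , t↑ , _) = thin (stage k) in
      (λ m → s (suc (t m))) , λ i<j → s↑ (s≤s (t↑ i<j))
    a : ℕ → ℕ
    a k = proj₁ (stage k) 0
    colour : ∀ k → (∀ m → A (a k) (proj₁ (stage (suc k)) m)) ⊎ (∀ m → B (a k) (proj₁ (stage (suc k)) m))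
    colour k = proj₂ (proj₂ (thin (stage k)))
    a↑ : Increasing a
    a↑ = step⇒increasing a λ k → proj₂ (stage k) (s≤s z≤n)
    range : ∀ d k m → Σ ℕ λ m′ → proj₁ (stage (d + k)) m ≡ proj₁ (stage k) m′
    range zero    k m = m , refl
    range (suc d) k m = range d k _
    -- The stages are nested, so for i < j the term `a j` belongs to stage i + 1 and inherits what
    -- holds throughout that stage.
    later : ∀ {i j} → i < j → (P : ℕ → Set) → (∀ m → P (proj₁ (stage (suc i)) m)) → P (a j)
    later {i} i<j P h with m≤n⇒∃[o]m+o≡n i<j
    ... | d , eq = subst (P ∘ a) (trans (+-comm d (suc i)) eq)
                     (subst P (sym (proj₂ (range d (suc i) 0))) (h _))

  -- After thinning, the colour of a pair depends on its earlier member only; a second pigeonhole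
  -- makes it constant.
  ramsey : {A B : ℕ → ℕ → Set} → Uniform (λ i j → A i j ⊎ B i j) →
           Σ (ℕ → ℕ) λ t → Increasing t × (Uniform (A at t) ⊎ Uniform (B at t))
  ramsey {A} {B} e with pigeon (Thinning.colour e)
  ... | u , u↑ , inj₁ g = a ∘ u , a↑ ∘ u↑ , inj₁ λ i j i<j → later (u↑ i<j) (A (a (u i))) (g i)
    where open Thinning e
  ... | u , u↑ , inj₂ g = a ∘ u , a↑ ∘ u↑ , inj₂ λ i j i<j → later (u↑ i<j) (B (a (u i))) (g i)
    where open Thinning e

  ramsey₃ : {A B C : ℕ → ℕ → Set} → Uniform (λ i j → A i j ⊎ B i j ⊎ C i j) →
            Σ (ℕ → ℕ) λ t → Increasing t × (Uniform (A at t) ⊎ Uniform (B at t) ⊎ Uniform (C at t))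
  ramsey₃ {A} {B} {C} e with ramsey {A} {λ i j → B i j ⊎ C i j} e
  ... | t , t↑ , inj₁ h = t , t↑ , inj₁ h
  ... | t , t↑ , inj₂ h with ramsey {B at t} {C at t} h
  ...   | u , u↑ , h′ = t ∘ u , t↑ ∘ u↑ , inj₂ h′

  -- The colourings are treated one at a time; what is already uniform remains so on a subsequence.
  ramseyFin : ∀ k {A B C : Fin k → ℕ → ℕ → Set} →
    (∀ m → Uniform (λ i j → A m i j ⊎ B m i j ⊎ C m i j)) →
    Σ (ℕ → ℕ) λ t → Increasing t × (∀ m → Uniform (A m at t) ⊎ Uniform (B m at t) ⊎ Uniform (C m at t))
  ramseyFin zero    e = id , id , λ ()
  ramseyFin (suc k) {A} {B} {C} e with ramseyFin k (e ∘ suc)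
  ... | t , t↑ , h with ramsey₃ {A zero at t} {B zero at t} {C zero at t} (λ i j i<j → e zero _ _ (t↑ i<j))
  ...   | u , u↑ , h₀ = t ∘ u , t↑ ∘ u↑ , λ where
    zero    → h₀
    (suc m) → Sum.map (restrict u↑) (Sum.map (restrict u↑) (restrict u↑)) (h m)

  -- Finitely many representatives or an infinite independent sequence

  module _ {A : Set} (_~_ : A → A → Set₁) (~-sym : ∀ {x y} → x ~ y → y ~ x) where

    Independent : ∀ {k} → (Fin k → A) → Set₁
    Independent c = ∀ m m′ → m ≢ m′ → ¬ (c m ~ c m′)

    Family : ℕ → Set₁
    Family k = Σ (Fin k → A) Independent

    New : ∀ {k} → (Fin k → A) → A → Set₁
    New c a = ∀ m → ¬ (a ~ c m)

    add : ∀ {k} (c : Family k) (a : A) → New (proj₁ c) a → Family (suc k)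
    add (c , ind) a new = c′ , ind′
      where
      c′ : Fin _ → A
      c′ zero    = a
      c′ (suc m) = c m
      ind′ : Independent c′
      ind′ zero    zero     m≢m′ = ⊥-elim (m≢m′ refl)
      ind′ zero    (suc m′) _    = new m′
      ind′ (suc m) zero     _    = new m ∘ ~-sym
      ind′ (suc m) (suc m′) m≢m′ = ind m m′ (m≢m′ ∘ cong suc)

    -- If no finite independent family represents everything, each one can be enlarged, and the
    -- elements added successively form the sequence.
    representatives-or-independent-sequence :
      (Σ ℕ λ k → Σ (Family k) λ c → ∀ a → Σ (Fin k) λ m → a ~ proj₁ c m) ⊎
      (Σ (ℕ → A) λ s → ∀ {i j} → i < j → ¬ (s j ~ s i))
    representatives-or-independent-sequence
      with em {Σ ℕ λ k → Σ (Family k) λ c → ∀ a → Σ (Fin k) λ m → a ~ proj₁ c m}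
    ... | yes r = inj₁ r
    ... | no ¬r = inj₂ (s , λ i<j r → let (m , eq) = earlier i<j in
                          proj₂ (new (fam _)) m (subst (s _ ~_) (sym eq) r))
      where
      new : ∀ {k} (c : Family k) → Σ A (New (proj₁ c))
      new c with em {Σ A (New (proj₁ c))}
      ... | yes n = n
      ... | no ¬n = ⊥-elim (¬r (_ , c , represented))
        where
        represented : ∀ a → Σ (Fin _) λ m → a ~ proj₁ c m
        represented a with em {Σ (Fin _) λ m → a ~ proj₁ c m}
        ... | yes h = h
        ... | no ¬h = ⊥-elim (¬n (a , λ m h → ¬h (m , h)))
      fam : ∀ k → Family k
      fam zero    = (λ ()) , λ ()
      fam (suc k) = add (fam k) (proj₁ (new (fam k))) (proj₂ (new (fam k)))
      s : ℕ → A
      s k = proj₁ (new (fam k))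
      earlier : ∀ {i j} → i < j → Σ (Fin j) λ m → proj₁ (fam j) m ≡ s i
      earlier {i} {suc j} i<1+j with m<1+n⇒m<n∨m≡n i<1+j
      ... | inj₂ refl = zero , refl
      ... | inj₁ i<j  = let (m , eq) = earlier i<j in suc m , eq

-- Coding monotone maps

down-closed⇒initial : ∀ {n} (P : Fin n → Set) → (∀ i → Dec (P i)) → (∀ {i j} → i F.< j → P j → P i) →
  Σ (Fin (suc n)) λ k → ∀ i → P i ⇔ (toℕ i < toℕ k)
down-closed⇒initial {zero}  P P? down = zero , λ ()
down-closed⇒initial {suc n} P P? down with P? zero
... | no ¬p = zero , λ where
  zero    → mk⇔ (λ p → ⊥-elim (¬p p)) (λ ())
  (suc i) → mk⇔ (λ p → ⊥-elim (¬p (down (s≤s z≤n) p))) (λ ())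
... | yes p with down-closed⇒initial (P ∘ suc) (P? ∘ suc) (λ lt → down (s≤s lt))
...   | k , h = suc k , λ where
  zero    → mk⇔ (λ _ → s≤s z≤n) (λ _ → p)
  (suc i) → mk⇔ (λ q → s≤s (Equivalence.to (h i) q)) (λ { (s≤s lt) → Equivalence.from (h i) lt })

Monotone : ∀ {n d} → (Fin n → Fin d) → Set
Monotone h = ∀ i j → i F.< j → h i F.≤ h j

module _ {n d : ℕ} where

  -- The number of i with h i ≤ c; these counts, one for each c, determine the monotone map h.
  cutPoint : (h : Fin n → Fin d) → Monotone h → ∀ (c : Fin d) → Σ (Fin (suc n)) λ k → ∀ i → h i F.≤ c ⇔ (toℕ i < toℕ k)
  cutPoint h mono c = down-closed⇒initial (λ i → h i F.≤ c) (λ i → h i F.≤? c) (λ lt le → ≤-trans (mono _ _ lt) le)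

  encode : (h : Fin n → Fin d) → Monotone h → Fin (suc n ^ d)
  encode h mono = F.funToFin {d} (λ c → proj₁ (cutPoint h mono c))

  -- h i ≤ c holds iff i lies before the cut of c. Since both maps have the same cuts, c = h′ i
  -- gives one inequality and c = h i the other.
  encode-injective : ∀ h mono h′ mono′ → encode h mono ≡ encode h′ mono′ → ∀ i → h i ≡ h′ i
  encode-injective h mono h′ mono′ eq i = FP.≤-antisym
      (Equivalence.from (proj₂ (cutPoint h mono (h′ i)) i)
        (subst (λ k → toℕ i < toℕ k) (sym (same (h′ i))) (Equivalence.to (proj₂ (cutPoint h′ mono′ (h′ i)) i) ≤-refl)))
      (Equivalence.from (proj₂ (cutPoint h′ mono′ (h i)) i)
        (subst (λ k → toℕ i < toℕ k) (same (h i)) (Equivalence.to (proj₂ (cutPoint h mono (h i)) i) ≤-refl)))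
    where
    same : ∀ (c : Fin d) → proj₁ (cutPoint h mono c) ≡ proj₁ (cutPoint h′ mono′ c)
    same c = trans (sym (FP.finToFun-funToFin (proj₁ ∘ cutPoint h mono) c))
             (trans (cong (λ w → F.finToFun {suc n} {d} w c) eq) (FP.finToFun-funToFin (proj₁ ∘ cutPoint h′ mono′) c))

-- Finite linear orders

does-true : {A : Set} (a? : Dec A) → does a? ≡ true → A
does-true (yes a) _ = a

record StrictTotal {A : Set} (_≺_ : A → A → Set) : Set where
  field
    ≺-irrefl : ∀ {x} → ¬ (x ≺ x)
    ≺-trans  : ∀ {x y z} → x ≺ y → y ≺ z → x ≺ z
    ≺-total  : ∀ {x y} → x ≢ y → x ≺ y ⊎ y ≺ x

module Sorting (em : ExcludedMiddle (lsuc lzero)) where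
  open Classical em

  injective⇒surjective : ∀ {n} (f : Fin n → Fin n) → Injective _≡_ _≡_ f → ∀ y → Σ (Fin n) λ x → f x ≡ y
  injective⇒surjective {suc n} f inj y with dec (Σ (Fin (suc n)) λ x → f x ≡ y)
  ... | yes s = s
  ... | no ¬s = ⊥-elim (1+n≰n (FP.injective⇒≤ {f = g} λ {i} {j} → inj ∘ FP.punchOut-injective (miss i) (miss j)))
    where
    miss : ∀ x → y ≢ f x
    miss x eq = ¬s (x , sym eq)
    g : Fin (suc n) → Fin n
    g x = F.punchOut (miss x)

  -- The rank of a point is the number of its predecessors. It is strictly monotone, hence injective
  -- by totality, hence bijective.
  sort : ∀ {n} (_≺_ : Fin n → Fin n → Set) → StrictTotal _≺_ → _≺_ ≃ F._<_
  sort {n} _≺_ st = record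
    { to = rank ; from = λ y → proj₁ (surj y)
    ; from-to = λ x → rank-injective (proj₂ (surj (rank x)))
    ; to-from = λ y → proj₂ (surj y)
    ; arc = mono ; arc⁻ = reflect }
    where
    open StrictTotal st
    before : Fin n → Subset n
    before i = tabulate (λ j → does (dec (j ≺ i)))
    ∈-before : ∀ {i j} → j ≺ i → j ∈ before i
    ∈-before {i} {j} lt = lookup⇒[]= j _ (trans (lookup∘tabulate _ j) (dec-true (dec (j ≺ i)) lt))
    before-∈ : ∀ {i j} → j ∈ before i → j ≺ i
    before-∈ {i} {j} mem = does-true (dec (j ≺ i)) (trans (sym (lookup∘tabulate _ j)) ([]=⇒lookup mem))
    smaller : ∀ {i j} → i ≺ j → ∣ before i ∣ < ∣ before j ∣
    smaller {i} lt = p⊂q⇒∣p∣<∣q∣ ((λ m → ∈-before (≺-trans (before-∈ m) lt)) , i , ∈-before lt , ≺-irrefl ∘ before-∈)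
    size< : ∀ i → ∣ before i ∣ < n
    size< i = subst (∣ before i ∣ <_) (∣⊤∣≡n n) (p⊂q⇒∣p∣<∣q∣ ((λ _ → ∈⊤) , i , ∈⊤ , ≺-irrefl ∘ before-∈))
    rank : Fin n → Fin n
    rank i = F.fromℕ< (size< i)
    mono : ∀ {i j} → i ≺ j → rank i F.< rank j
    mono {i} {j} lt = subst₂ _<_ (sym (FP.toℕ-fromℕ< (size< i))) (sym (FP.toℕ-fromℕ< (size< j))) (smaller lt)
    reflect : ∀ {i j} → rank i F.< rank j → i ≺ j
    reflect {i} {j} lt with i F.≟ j
    ... | yes refl = ⊥-elim (<-irrefl refl lt)
    ... | no ne with ≺-total ne
    ...   | inj₁ r = r
    ...   | inj₂ r = ⊥-elim (<-asym lt (mono r))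
    rank-injective : Injective _≡_ _≡_ rank
    rank-injective {i} {j} eq with i F.≟ j
    ... | yes e = e
    ... | no ne = ⊥-elim ([ (λ r → <⇒≢ (mono r) (cong toℕ eq)) , (λ r → <⇒≢ (mono r) (cong toℕ (sym eq))) ] (≺-total ne))
    surj : ∀ y → Σ (Fin n) λ x → rank x ≡ y
    surj = injective⇒surjective rank rank-injective

-- Polynomial profiles of lexicographical sums

module LexSum (em : ExcludedMiddle (lsuc lzero)) {d : ℕ} (D : Fin d → Fin d → Set) (Dt : IsTournament D)
              (Ts : Fin d → Tournament) (acyclic : ∀ i → Acyclic (Ts i)) where
  open Classical em
  open IsTournament Dt

  Point : Set
  Point = Σ (Fin d) λ i → V (Ts i)

  -- A linear order for listing vertices block after block: the blocks follow their indices,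
  -- whatever `D` says, and each block follows its own acyclic order.
  data _≺_ : Point → Point → Set where
    earlier : ∀ {i j x y} → i F.< j → (i , x) ≺ (j , y)
    within  : ∀ {i x y} → _⇒_ (Ts i) x y → (i , x) ≺ (i , y)

  ≺-strictTotal : StrictTotal _≺_
  ≺-strictTotal = record { ≺-irrefl = irr ; ≺-trans = tr ; ≺-total = tot }
    where
    irr : ∀ {a} → ¬ (a ≺ a)
    irr (earlier lt) = <-irrefl refl lt
    irr {i , x} (within r) = IsTournament.irrefl (isTournament (Ts i)) x r
    tr : ∀ {a b c} → a ≺ b → b ≺ c → a ≺ c
    tr (earlier p) (earlier q) = earlier (<-trans p q)
    tr (earlier p) (within _)  = earlier p
    tr (within _)  (earlier q) = earlier q
    -- Acyclicity makes a block transitive: an arc from z to x would close a 3-cycle.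
    tr {i , x} {_ , y} {_ , z} (within p) (within q) with dec (x ≡ z)
    ... | yes refl = ⊥-elim (IsTournament.antisym (isTournament (Ts i)) _ _ p q)
    ... | no ne with IsTournament.complete (isTournament (Ts i)) x z ne
    ...   | inj₁ r = within r
    ...   | inj₂ r = ⊥-elim (acyclic i x y z (p , q , r))
    tot : ∀ {a b} → a ≢ b → a ≺ b ⊎ b ≺ a
    tot {i , x} {j , y} ne with FP.<-cmp i j
    ... | tri< lt _ _ = inj₁ (earlier lt)
    ... | tri> _ _ gt = inj₂ (earlier gt)
    ... | tri≈ _ refl _ = Sum.map within within (IsTournament.complete (isTournament (Ts i)) x y (ne ∘ cong (i ,_)))

  ≺⇒≤ : ∀ {a b} → a ≺ b → proj₁ a F.≤ proj₁ b
  ≺⇒≤ (earlier lt) = <⇒≤ lt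
  ≺⇒≤ (within _)   = ≤-refl

  lex⇒ : ∀ {a b} → LexRel D Ts a b → (proj₁ a ≡ proj₁ b × a ≺ b) ⊎ D (proj₁ a) (proj₁ b)
  lex⇒ (inside r) = inj₁ (refl , within r)
  lex⇒ (across r) = inj₂ r

  lex⇐ : ∀ {a b} → (proj₁ a ≡ proj₁ b × a ≺ b) ⊎ D (proj₁ a) (proj₁ b) → LexRel D Ts a b
  lex⇐ (inj₁ (refl , earlier lt)) = ⊥-elim (<-irrefl refl lt)
  lex⇐ (inj₁ (refl , within r))   = inside r
  lex⇐ (inj₂ r)                   = across r

  -- The lexicographical sum of chains whose vertices, listed block after block, lie in the blocks h 0 ≤ h 1 ≤ … .
  Canonical : ∀ {n} → (Fin n → Fin d) → Fin n → Fin n → Set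
  Canonical h i j = (h i ≡ h j × i F.< j) ⊎ D (h i) (h j)

  canonical-isTournament : ∀ {n} (h : Fin n → Fin d) → IsTournament (Canonical h)
  canonical-isTournament h = record { irrefl = irr ; antisym = asym ; complete = comp }
    where
    irr : ∀ i → ¬ Canonical h i i
    irr i (inj₁ (_ , lt)) = <-irrefl refl lt
    irr i (inj₂ r) = irrefl _ r
    asym : ∀ i j → Canonical h i j → ¬ Canonical h j i
    asym i j (inj₁ (_ , p)) (inj₁ (_ , q)) = <-asym p q
    asym i j (inj₁ (e , _)) (inj₂ r) = irrefl _ (subst (λ c → D c (h i)) (sym e) r)
    asym i j (inj₂ r) (inj₁ (e , _)) = irrefl _ (subst (λ c → D c (h j)) (sym e) r)
    asym i j (inj₂ p) (inj₂ q) = antisym _ _ p q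
    comp : ∀ i j → i ≢ j → Canonical h i j ⊎ Canonical h j i
    comp i j ne with h i F.≟ h j | FP.<-cmp i j
    ... | no c  | _ = Sum.map inj₂ inj₂ (complete _ _ c)
    ... | yes c | tri< lt _ _ = inj₁ (inj₁ (c , lt))
    ... | yes c | tri≈ _ e _  = ⊥-elim (ne e)
    ... | yes c | tri> _ _ gt = inj₂ (inj₁ (sym c , gt))

  canonical-cong : ∀ {n} {h h′ : Fin n → Fin d} → (∀ i → h i ≡ h′ i) → Canonical h ≃ Canonical h′
  canonical-cong {h = h} {h′} eq = record
    { to = id ; from = id ; from-to = λ _ → refl ; to-from = λ _ → refl
    ; arc  = Sum.map (λ (e , lt) → trans (sym (eq _)) (trans e (eq _)) , lt) (subst₂ D (eq _) (eq _))
    ; arc⁻ = Sum.map (λ (e , lt) → trans (eq _) (trans e (sym (eq _))) , lt) (subst₂ D (sym (eq _)) (sym (eq _))) }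

  -- Listing the chosen vertices along `≺` makes their block indices monotone, and vertices of one
  -- block are then joined in the order of the list.
  canonical-form : ∀ {n} (g : Fin n → Point) → Injective _≡_ _≡_ g →
    Σ (Fin n → Fin d) λ h → Monotone h × Canonical h ≃ (λ i j → LexRel D Ts (g i) (g j))
  canonical-form {n} g inj = h , (λ _ _ lt → ≺⇒≤ (sorted lt)) , record
    { to = from s ; from = to s ; from-to = to-from s ; to-from = from-to s
    ; arc  = λ c → lex⇐ (Sum.map₁ (λ (e , lt) → e , sorted lt) c)
    ; arc⁻ = λ {i} {j} r → Sum.map₁ (λ (e , lt) → e , subst₂ F._<_ (to-from s i) (to-from s j) (arc s lt)) (lex⇒ r) }
    where
    s : (λ i j → g i ≺ g j) ≃ F._<_
    s = Sorting.sort em (λ i j → g i ≺ g j) (record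
      { ≺-irrefl = ≺-irrefl ; ≺-trans = ≺-trans ; ≺-total = λ ne → ≺-total (ne ∘ inj) })
      where open StrictTotal ≺-strictTotal
    h : Fin n → Fin d
    h k = proj₁ (g (from s k))
    sorted : ∀ {i j} → i F.< j → g (from s i) ≺ g (from s j)
    sorted {i} {j} lt = arc⁻ s (subst₂ F._<_ (sym (to-from s i)) (sym (to-from s j)) lt)

  Code : ∀ n → Fin (suc n ^ d) → Set
  Code n m = Σ (Fin n → Fin d) λ h → Σ (Monotone h) λ mono → encode h mono ≡ m

  decoded : ∀ n → Fin (suc n ^ d) → FinTour n
  decoded n m with dec (Code n m)
  ... | yes (h , _) = Canonical h , canonical-isTournament h
  -- No monotone map has this code, so any tournament may stand here; a chain is taken.
  ... | no _ = F._<_ , record { irrefl = λ _ → <-irrefl refl ; antisym = λ _ _ → <-asym ; complete = comp }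
    where
    comp : ∀ i j → i ≢ j → i F.< j ⊎ j F.< i
    comp i j ne with FP.<-cmp i j
    ... | tri< lt _ _ = inj₁ lt
    ... | tri≈ _ e _  = ⊥-elim (ne e)
    ... | tri> _ _ gt = inj₂ gt

  decoded-encode : ∀ {n} (h : Fin n → Fin d) (mono : Monotone h) → proj₁ (decoded n (encode h mono)) ≃ Canonical h
  decoded-encode {n} h mono with dec (Code n (encode h mono))
  ... | yes (h′ , mono′ , eq) = canonical-cong (encode-injective h′ mono′ h mono eq)
  ... | no ¬c = ⊥-elim (¬c (h , mono , refl))

  polyBounded : ∀ T → _⇒_ T ≃ LexRel D Ts → PolyBounded T
  -- The d cuts have n + 1 possible values each, whence the bound (n + 1) ^ d.
  polyBounded T φ = 1 , d , λ n → subst (ProfileAtMost T n) (sym (*-identityˡ (suc n ^ d))) (decoded n , λ g inj →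
    let (h , mono , e) = canonical-form (to φ ∘ g) (inj ∘ to-injective φ) in
    encode h mono , ≃⇒Iso (≃-trans (≃-trans (decoded-encode h mono) e)
      (record { to = id ; from = id ; from-to = λ _ → refl ; to-from = λ _ → refl ; arc = arc⁻ φ ; arc⁻ = arc φ })))

lexSum⇒polyBounded : ExcludedMiddle (lsuc lzero) → ∀ T → LexSumOfAcyclic T → PolyBounded T
lexSum⇒polyBounded em T (d , (D , Dt) , Ts , acyclic , iso) = LexSum.polyBounded em D Dt Ts acyclic T (Iso⇒≃ iso)

-- Acyclic modules and their equivalence classes

flip-tournament : Tournament → Tournament
flip-tournament T = record
  { V = V T ; _⇒_ = λ x y → _⇒_ T y x
  ; isTournament = record
    { irrefl = irrefl ; antisym = λ x y → antisym y x ; complete = λ x y ne → Sum.swap (complete x y ne) } }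
  where open IsTournament (isTournament T)

module Arcs (T : Tournament) where
  open Tournament T public using () renaming (V to X; _⇒_ to _⟶_)
  open IsTournament (isTournament T) public

  ⟶⇒≢ : ∀ {x y} → x ⟶ y → x ≢ y
  ⟶⇒≢ {x} r refl = irrefl x r

  flip-arc : ∀ {x y} → x ≢ y → ¬ (x ⟶ y) → y ⟶ x
  flip-arc {x} {y} ne nr with complete x y ne
  ... | inj₁ r = ⊥-elim (nr r)
  ... | inj₂ r = r

  Cycle : X → X → X → Set
  Cycle x y z = x ⟶ y × y ⟶ z × z ⟶ x

  -- Homogeneity is demanded for arcs leaving `M`; by completeness it follows for arcs entering `M`,
  -- see `homogeneous⁻`.
  record AcyclicModule (M : X → Set) : Set where
    field
      homogeneous : ∀ {x y z} → M x → M y → ¬ M z → x ⟶ z → y ⟶ z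
      no-cycle    : ∀ {x y z} → M x → M y → M z → ¬ Cycle x y z
  open AcyclicModule public

  homogeneous⁻ : ∀ {M} → AcyclicModule M → ∀ {x y z} → M x → M y → ¬ M z → z ⟶ x → z ⟶ y
  homogeneous⁻ am {x} {y} {z} mx my ¬mz r with complete z y (λ { refl → ¬mz my })
  ... | inj₁ s = s
  ... | inj₂ s = ⊥-elim (antisym _ _ r (homogeneous am my mx ¬mz s))

  infix 4 _~_
  _~_ : X → X → Set₁
  x ~ y = Σ (X → Set) λ M → AcyclicModule M × M x × M y

  ~-refl : ∀ {x} → x ~ x
  ~-refl {x} = (_≡ x) , record { homogeneous = λ { refl refl _ r → r } ; no-cycle = λ { refl refl _ (r , _) → irrefl _ r } } , refl , refl

  ~-sym : ∀ {x y} → x ~ y → y ~ x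
  ~-sym (M , am , mx , my) = M , am , my , mx

module Modules (em : ExcludedMiddle (lsuc lzero)) (T : Tournament) where
  open Classical em
  open Arcs T

  -- A vertex z outside `M` sees x and y alike, which y → z → x violates; inside `M` there are no
  -- cycles.
  closed : ∀ {M} → AcyclicModule M → ∀ {x y z} → M x → M y → ¬ Cycle x y z
  closed {M} am {x} {y} {z} mx my c@(xy , yz , zx) with dec (M z)
  ... | yes mz = no-cycle am mx my mz c
  ... | no ¬mz = antisym _ _ zx (homogeneous am my mx ¬mz yz)

  -- Homogeneity passes from one set to the other through the common vertex c. Of the three vertices
  -- of a cycle, two lie in the same set, so `closed` applies.
  union : ∀ {A B c} → AcyclicModule A → AcyclicModule B → A c → B c →
          AcyclicModule (λ x → A x ⊎ B x)
  union {A} {B} {c} a b ac bc = record { homogeneous = hom ; no-cycle = cyc }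
    where
    hom : ∀ {x y z} → A x ⊎ B x → A y ⊎ B y → ¬ (A z ⊎ B z) → x ⟶ z → y ⟶ z
    hom (inj₁ x) (inj₁ y) nz r = homogeneous a x y (nz ∘ inj₁) r
    hom (inj₂ x) (inj₂ y) nz r = homogeneous b x y (nz ∘ inj₂) r
    hom (inj₁ x) (inj₂ y) nz r = homogeneous b bc y (nz ∘ inj₂) (homogeneous a x ac (nz ∘ inj₁) r)
    hom (inj₂ x) (inj₁ y) nz r = homogeneous a ac y (nz ∘ inj₁) (homogeneous b x bc (nz ∘ inj₂) r)
    cyc : ∀ {x y z} → A x ⊎ B x → A y ⊎ B y → A z ⊎ B z → ¬ Cycle x y z
    cyc (inj₁ x) (inj₁ y) _        c             = closed a x y c
    cyc (inj₂ x) (inj₂ y) _        c             = closed b x y c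
    cyc (inj₁ x) (inj₂ y) (inj₁ z) (p , q , r)   = closed a z x (r , p , q)
    cyc (inj₁ x) (inj₂ y) (inj₂ z) (p , q , r)   = closed b y z (q , r , p)
    cyc (inj₂ x) (inj₁ y) (inj₁ z) (p , q , r)   = closed a y z (q , r , p)
    cyc (inj₂ x) (inj₁ y) (inj₂ z) (p , q , r)   = closed b z x (r , p , q)

  ~-trans : ∀ {x y z} → x ~ y → y ~ z → x ~ z
  ~-trans (A , a , ax , ay) (B , b , by , bz) = (λ v → A v ⊎ B v) , union a b ay by , inj₁ ax , inj₂ bz

  ~-acyclic : ∀ {x y z} → x ~ y → ¬ Cycle x y z
  ~-acyclic (M , am , mx , my) = closed am mx my

  -- Homogeneity moves the arc c ⟶ d first inside the module of v and c, then inside that of w and d.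
  ~-arc : ∀ {c d v w} → ¬ (c ~ d) → v ~ c → w ~ d → c ⟶ d → v ⟶ w
  ~-arc c≁d v~c@(M , m , Mv , Mc) w~d@(N , n , Nw , Nd) r =
    homogeneous⁻ n Nd Nw (λ Nv → c≁d (~-trans (~-sym v~c) (N , n , Nv , Nd)))
      (homogeneous m Mc Mv (λ Md → c≁d (M , m , Mc , Md)) r)

  Interval : X → X → X → Set
  Interval x y v = v ≡ x ⊎ v ≡ y ⊎ (x ⟶ v × v ⟶ y)

  -- Without such a cycle the interval would be an acyclic module. Suppose a → z → b with a and b
  -- inside and z outside. Then x → z, or else x, a, z form a forbidden cycle, and z → y, or else b,
  -- y, z do; so z is inside after all.
  ≁⇒cycle : ∀ {x y} → x ⟶ y → ¬ (x ~ y) →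
            Σ X λ p → Σ X λ q → Σ X λ r → Interval x y p × Interval x y q × Cycle p q r
  ≁⇒cycle {x} {y} xy x≁y with dec (Σ X λ p → Σ X λ q → Σ X λ r → Interval x y p × Interval x y q × Cycle p q r)
  ... | yes w = w
  ... | no ¬w = ⊥-elim (x≁y (Interval x y , record { homogeneous = hom ; no-cycle = λ i j _ → none i j }
                            , inj₁ refl , inj₂ (inj₁ refl)))
    where
    I : X → Set
    I = Interval x y
    none : ∀ {p q r} → I p → I q → ¬ Cycle p q r
    none i j c = ¬w (_ , _ , _ , i , j , c)
    fromx : ∀ {a} → I a → a ≢ x → x ⟶ a
    fromx (inj₁ e) ne = ⊥-elim (ne e)
    fromx (inj₂ (inj₁ refl)) ne = xy
    fromx (inj₂ (inj₂ (r , _))) ne = r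
    toy : ∀ {a} → I a → a ≢ y → a ⟶ y
    toy (inj₁ refl) ne = xy
    toy (inj₂ (inj₁ e)) ne = ⊥-elim (ne e)
    toy (inj₂ (inj₂ (_ , r))) ne = r
    hom : ∀ {a b z} → I a → I b → ¬ I z → a ⟶ z → b ⟶ z
    hom {a} {b} {z} ia ib nz az with complete b z (λ { refl → nz ib })
    ... | inj₁ bz = bz
    ... | inj₂ zb with dec (a ≡ b)
    ...   | yes refl = az
    ...   | no a≢b with complete a b a≢b
    ...     | inj₂ ba = ⊥-elim (none ib ia (ba , az , zb))
    ...     | inj₁ _  = ⊥-elim (nz (inj₂ (inj₂ (xz , zy))))
      where
      xz : x ⟶ z
      xz = flip-arc (λ { refl → nz (inj₁ refl) }) λ zx →
        none (inj₁ refl) ia (fromx ia (λ { refl → antisym _ _ az zx }) , az , zx)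
      zy : z ⟶ y
      zy = flip-arc (λ { refl → nz (inj₂ (inj₁ refl)) }) λ yz →
        none ib (inj₂ (inj₁ refl)) (toy ib (λ { refl → antisym _ _ zb yz }) , yz , zb)

  finitely-many-classes⇒lexSum : ∀ {k} (c : Fin k → X) → (∀ m m′ → m ≢ m′ → ¬ (c m ~ c m′)) →
    (∀ v → Σ (Fin k) λ m → v ~ c m) → LexSumOfAcyclic T
  finitely-many-classes⇒lexSum {k} c ind cover = k , (D , Dt) , Ts , acyclic , ≃⇒Iso iso
    where
    cls : X → Fin k
    cls v = proj₁ (cover v)
    D : Fin k → Fin k → Set
    D i j = c i ⟶ c j
    c-injective : ∀ {i j} → i ≢ j → c i ≢ c j
    c-injective {i} {j} ne e = ind i j ne (subst (c i ~_) e ~-refl)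
    Dt : IsTournament D
    Dt = record { irrefl = λ i → irrefl _ ; antisym = λ i j → antisym _ _
                ; complete = λ i j ne → complete _ _ (c-injective ne) }
    -- Blocks are cut out by the index of the representative, because `v ~ c i` lives in `Set₁` and
    -- cannot define a vertex type in `Set`.
    W : Fin k → Set
    W i = Σ X λ v → cls v ≡ i
    W-≡ : ∀ {i} {v w : W i} → proj₁ v ≡ proj₁ w → v ≡ w
    W-≡ {v = v , refl} {w = .v , refl} refl = refl
    Ts : Fin k → Tournament
    Ts i = record { V = W i ; _⇒_ = λ v w → proj₁ v ⟶ proj₁ w
                  ; isTournament = record { irrefl = λ v → irrefl _ ; antisym = λ v w → antisym _ _
                                          ; complete = λ v w ne → complete _ _ (ne ∘ W-≡) } }
    rep : ∀ {i} (v : W i) → proj₁ v ~ c i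
    rep (v , refl) = proj₂ (cover v)
    acyclic : ∀ i → Acyclic (Ts i)
    acyclic i v w _ = ~-acyclic (~-trans (rep v) (~-sym (rep w)))
    arc′ : ∀ {i j} → (v : W i) (w : W j) → proj₁ v ⟶ proj₁ w → LexRel D Ts (i , v) (j , w)
    arc′ {i} {j} v w r with i F.≟ j
    ... | yes refl = inside r
    ... | no i≢j with complete _ _ (c-injective i≢j)
    ...   | inj₁ ij = across ij
    ...   | inj₂ ji = ⊥-elim (antisym _ _ r (~-arc (ind j i (i≢j ∘ sym)) (rep w) (rep v) ji))
    arc′⁻ : ∀ {i j} → (v : W i) (w : W j) → LexRel D Ts (i , v) (j , w) → proj₁ v ⟶ proj₁ w
    arc′⁻ v w (inside r) = r
    arc′⁻ {i} {j} v w (across r) = ~-arc (ind i j λ { refl → irrefl _ r }) (rep v) (rep w) r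
    iso : _⟶_ ≃ LexRel D Ts
    iso = record
      { to = λ v → cls v , v , refl
      ; from = λ { (_ , v , _) → v }
      ; from-to = λ _ → refl
      ; to-from = λ { (_ , v , refl) → refl }
      ; arc = arc′ _ _
      ; arc⁻ = arc′⁻ _ _ }

-- Codings of binary words and lower bounds on the profile

-- Words coded by n + 1 vertices, the mark being one of them. Only the first n / 3 letters need be decoded, so that
-- the codes may consist of blocks of three vertices.
record Coding (T : Tournament) (n : ℕ) : Set where
  open Arcs T
  field
    mark      : X
    code      : (ℕ → Bool) → Fin n → X
    injective : ∀ u → Injective _≡_ _≡_ (code u)
    unmarked  : ∀ u i → mark ≢ code u i
    decode    : ∀ u u′ (e : Induced T (code u) ≃ Induced T (code u′)) →
                (∀ i → mark ⟶ code u i → mark ⟶ code u′ (to e i)) →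
                (∀ i → code u i ⟶ mark → code u′ (to e i) ⟶ mark) →
                ∀ b → suc b * 3 ≤ n → u b ≡ u′ b

flip-coding : ∀ {T n} → Coding (flip-tournament T) n → Coding T n
flip-coding c = record
  { mark = mark ; code = code ; injective = injective ; unmarked = unmarked
  ; decode = λ u u′ e out inn → decode u u′
      (record { to = to e ; from = from e ; from-to = from-to e ; to-from = to-from e ; arc = arc e ; arc⁻ = arc⁻ e }) inn out }
  where open Coding c

third : ℕ → ℕ
third (suc (suc (suc n))) = suc (third n)
third _                   = 0

third*3≤ : ∀ n → third n * 3 ≤ n
third*3≤ 0 = z≤n
third*3≤ 1 = z≤n
third*3≤ 2 = z≤n
third*3≤ (suc (suc (suc n))) = s≤s (s≤s (s≤s (third*3≤ n)))

third[m*3] : ∀ m → third (m * 3) ≡ m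
third[m*3] zero    = refl
third[m*3] (suc m) = cong suc (third[m*3] m)

funToFin-cong : ∀ {m n} {f g : Fin m → Fin n} → (∀ i → f i ≡ g i) → F.funToFin f ≡ F.funToFin g
funToFin-cong {zero}  h = refl
funToFin-cong {suc m} h = cong₂ F.combine (h zero) (funToFin-cong (h ∘ suc))

finToFun-injective : ∀ {m n} (w w′ : Fin (n ^ m)) → (∀ i → F.finToFun {n} {m} w i ≡ F.finToFun w′ i) → w ≡ w′
finToFun-injective {m} {n} w w′ h =
  trans (sym (FP.funToFin-finToFin {m} w)) (trans (funToFin-cong h) (FP.funToFin-finToFin {m} w′))

bit : Fin 2 → Bool
bit zero    = false
bit (suc _) = true

bit-injective : ∀ {i j} → bit i ≡ bit j → i ≡ j
bit-injective {zero}     {zero}     _ = refl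
bit-injective {suc zero} {suc zero} _ = refl

word : ∀ m → Fin (2 ^ m) → ℕ → Bool
word m w b with b <? m
... | yes b<m = bit (F.finToFun {2} {m} w (F.fromℕ< b<m))
-- Codings take infinite words, so the letters from position m on are padded.
... | no  _   = false

word-toℕ : ∀ m w (i : Fin m) → word m w (toℕ i) ≡ bit (F.finToFun w i)
word-toℕ m w i with toℕ i <? m
... | yes i<m = cong (bit ∘ F.finToFun w) (FP.fromℕ<-toℕ i i<m)
... | no  i≮m = ⊥-elim (i≮m (FP.toℕ<n i))

word-injective : ∀ m w w′ → (∀ b → b < m → word m w b ≡ word m w′ b) → w ≡ w′
word-injective m w w′ h = finToFun-injective {m} {2} w w′ λ i → bit-injective
  (trans (sym (word-toℕ m w i)) (trans (h (toℕ i) (FP.toℕ<n i)) (word-toℕ m w′ i)))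

induced-isTournament : ∀ T {n} {g : Fin n → V T} → Injective _≡_ _≡_ g → IsTournament (Induced T g)
induced-isTournament T inj = record
  { irrefl = λ i → irrefl _ ; antisym = λ i j → antisym _ _ ; complete = λ i j ne → complete _ _ (ne ∘ inj) }
  where open IsTournament (isTournament T)

module _ {n : ℕ} {R S : Fin (suc n) → Fin (suc n) → Set} where

  unshift : (f : Fin (suc n) → Fin (suc n)) → Injective _≡_ _≡_ f → f zero ≡ zero →
            ∀ i → Σ (Fin n) λ j → f (suc i) ≡ suc j
  unshift f inj f0 i with f (suc i) in eq
  ... | suc j = j , refl
  ... | zero with inj (trans eq (sym f0))
  ...   | ()

  ≃-tail : (e : R ≃ S) → to e zero ≡ zero →
           Σ ((λ i j → R (suc i) (suc j)) ≃ (λ i j → S (suc i) (suc j))) λ e′ → ∀ i → to e (suc i) ≡ suc (to e′ i)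
  ≃-tail e e0 = record
    { to = λ i → proj₁ (t i) ; from = λ i → proj₁ (f i)
    ; from-to = λ i → FP.suc-injective (trans (sym (proj₂ (f _))) (trans (cong (from e) (sym (proj₂ (t i)))) (from-to e (suc i))))
    ; to-from = λ i → FP.suc-injective (trans (sym (proj₂ (t _))) (trans (cong (to e) (sym (proj₂ (f i)))) (to-from e (suc i))))
    ; arc = λ {i} {j} r → subst₂ S (proj₂ (t i)) (proj₂ (t j)) (arc e r)
    ; arc⁻ = λ {i} {j} s → arc⁻ e (subst₂ S (sym (proj₂ (t i))) (sym (proj₂ (t j))) s) } , λ i → proj₂ (t i)
    where
    t = unshift (to e) (to-injective e) e0
    f = unshift (from e) (to-injective (≃-sym e)) (trans (cong (from e) (sym e0)) (from-to e zero))

module Counting (em : ExcludedMiddle (lsuc lzero)) (T : Tournament) where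
  open Classical em
  open Arcs T

  module _ {n : ℕ} (cd : Coding T n) where
    open Coding cd

    q : Fin (2 ^ third n) → Fin (suc n) → X
    q w zero    = mark
    q w (suc i) = code (word (third n) w) i

    q-injective : ∀ w → Injective _≡_ _≡_ (q w)
    q-injective w {zero}  {zero}  _ = refl
    q-injective w {zero}  {suc j} e = ⊥-elim (unmarked _ j e)
    q-injective w {suc i} {zero}  e = ⊥-elim (unmarked _ i (sym e))
    q-injective w {suc i} {suc j} e = cong suc (injective _ e)

    -- An isomorphism that fixes the mark restricts to the codes and respects their arcs with the
    -- mark, so the word can be decoded.
    marked : ∀ w w′ (e : Induced T (q w) ≃ Induced T (q w′)) → to e zero ≡ zero → w ≡ w′
    marked w w′ e e0 with ≃-tail {R = Induced T (q w)} {S = Induced T (q w′)} e e0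
    ... | e′ , h = word-injective (third n) w w′ λ b b<m → decode _ _ e′
      (λ i r → subst₂ (λ x y → q w′ x ⟶ q w′ y) e0 (h i) (arc e {zero} {suc i} r))
      (λ i r → subst₂ (λ x y → q w′ x ⟶ q w′ y) (h i) e0 (arc e {suc i} {zero} r))
      b (≤-trans (*-monoˡ-≤ 3 b<m) (third*3≤ n))

    _≈_ : Fin (2 ^ third n) → Fin (2 ^ third n) → Set₁
    w ≈ w′ = Lift (lsuc lzero) (Induced T (q w) ≃ Induced T (q w′))

    -- Each marked code is isomorphic to a representative. That representative and the image of the
    -- mark in it determine the word, so the words inject into k (n + 1) pairs.
    coding⇒many : Σ ℕ λ k → (2 ^ third n ≤ k * suc n) × ProfileAtLeast T (suc n) k
    coding⇒many with representatives-or-independent-sequence _≈_ (λ h → lift (≃-sym (lower h)))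
    ... | inj₁ (k , (c , ind) , cover) = k , FP.injective⇒≤ {f = position} position-injective ,
        (λ m → Induced T (q (c m)) , induced-isTournament T (q-injective (c m))) ,
        (λ m → q (c m) , q-injective (c m) , λ i j → mk⇔ id id) ,
        λ m m′ ne iso → ind m m′ ne (lift (Iso⇒≃ iso))
      where
      iso : ∀ w → Induced T (q w) ≃ Induced T (q (c (proj₁ (cover w))))
      iso w = lower (proj₂ (cover w))
      position : Fin (2 ^ third n) → Fin (k * suc n)
      position w = F.combine (proj₁ (cover w)) (to (iso w) zero)
      same : ∀ w w′ {m m′} → m ≡ m′ → (e : Induced T (q w) ≃ Induced T (q (c m))) (e′ : Induced T (q w′) ≃ Induced T (q (c m′))) →
             to e zero ≡ to e′ zero → w ≡ w′
      same w w′ refl e e′ eq = marked w w′ (≃-trans e (≃-sym e′)) (trans (cong (from e′) eq) (from-to e′ zero))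
      position-injective : Injective _≡_ _≡_ position
      position-injective {w} {w′} eq = let (eq₁ , eq₂) = FP.combine-injective _ _ _ _ eq in same w w′ eq₁ (iso w) (iso w′) eq₂
    -- Such a sequence would be injective, but there are finitely many words.
    ... | inj₂ (s , ind) = ⊥-elim (FP.ℕ→Fin-notInjective s s-injective)
      where
      distinct : ∀ {i j} → i < j → s i ≢ s j
      distinct {j = j} i<j eq = ind i<j (subst (s j ≈_) (sym eq) (lift ≃-refl))
      s-injective : Injective _≡_ _≡_ s
      s-injective {i} {j} eq with <-cmp i j
      ... | tri< i<j _ _ = ⊥-elim (distinct i<j eq)
      ... | tri≈ _ i≡j _ = i≡j
      ... | tri> _ _ j<i = ⊥-elim (distinct j<i (sym eq))

profile-pigeonhole : ∀ {T n k l} → ProfileAtLeast T n k → ProfileAtMost T n l → k ≤ l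
profile-pigeonhole {T} {n} {k} {l} (S , emb , distinct) (U , cover) = FP.injective⇒≤ {f = class} class-injective
  where
  covered : ∀ m → Σ (Fin l) λ c → proj₁ (U c) ≃ proj₁ (S m)
  covered m = let (g , inj , arcs) = emb m ; (c , iso) = cover g inj in c , ≃-trans (Iso⇒≃ iso) (record
    { to = id ; from = id ; from-to = λ _ → refl ; to-from = λ _ → refl
    ; arc = Equivalence.from (arcs _ _) ; arc⁻ = Equivalence.to (arcs _ _) })
  class : Fin k → Fin l
  class m = proj₁ (covered m)
  class-injective : Injective _≡_ _≡_ class
  class-injective {m} {m′} eq with m F.≟ m′
  ... | yes e = e
  ... | no ne = ⊥-elim (distinct m m′ ne (≃⇒Iso
    (≃-trans (≃-sym (proj₂ (covered m))) (subst (λ c → proj₁ (U c) ≃ proj₁ (S m′)) (sym eq) (proj₂ (covered m′))))))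

-- Numerical estimates and growth

n<2^n : ∀ n → n < 2 ^ n
n<2^n zero    = s≤s z≤n
n<2^n (suc n) = ≤-trans (+-mono-≤ {1} (m^n>0 2 n) (n<2^n n)) (≤-reflexive (cong (2 ^ n +_) (sym (+-identityʳ (2 ^ n)))))

-- With m = 2 ^ t and t = 2 (C + 2 D), the right-hand side is at most 2 ^ (C + (t + 3) D) < 2 ^ (2 ^ t).
exponential-beats-polynomial : ∀ C D → ¬ (∀ m → 2 ^ m ≤ C * (2 + m * 3) ^ D)
exponential-beats-polynomial C D h = 1+n≰n (≤-trans exponents (^-cancelʳ-≤ 2 (s≤s (s≤s z≤n)) powers))
  where
  open ≤-Reasoning
  c t : ℕ
  c = C + 2 * D
  t = c + c
  powers : 2 ^ (2 ^ t) ≤ 2 ^ (C + (t + 3) * D)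
  powers = begin
    2 ^ (2 ^ t)                       ≤⟨ h (2 ^ t) ⟩
    C * (2 + 2 ^ t * 3) ^ D           ≤⟨ *-mono-≤ (<⇒≤ (n<2^n C)) (^-monoˡ-≤ D base) ⟩
    2 ^ C * (2 ^ (t + 3)) ^ D         ≡⟨ cong (2 ^ C *_) (^-*-assoc 2 (t + 3) D) ⟩
    2 ^ C * 2 ^ ((t + 3) * D)         ≡⟨ ^-distribˡ-+-* 2 C ((t + 3) * D) ⟨
    2 ^ (C + (t + 3) * D)             ∎
    where
    base : 2 + 2 ^ t * 3 ≤ 2 ^ (t + 3)
    base = begin
      2 + 2 ^ t * 3             ≤⟨ +-monoˡ-≤ (2 ^ t * 3) (*-monoʳ-≤ 2 (m^n>0 2 t)) ⟩
      2 * 2 ^ t + 2 ^ t * 3     ≤⟨ m≤m+n _ (3 * 2 ^ t) ⟩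
      2 * 2 ^ t + 2 ^ t * 3 + 3 * 2 ^ t ≡⟨ eight (2 ^ t) ⟩
      2 ^ t * 2 ^ 3             ≡⟨ ^-distribˡ-+-* 2 t 3 ⟨
      2 ^ (t + 3)               ∎
      where
      eight : ∀ x → 2 * x + x * 3 + 3 * x ≡ x * 8
      eight = solve-∀
  exponents : suc (C + (t + 3) * D) ≤ 2 ^ t
  exponents = begin
    -- The added terms complete the square of c + 1.
    suc (C + (t + 3) * D)                         ≤⟨ m≤m+n _ (c * C + C + D) ⟩
    suc (C + (t + 3) * D) + (c * C + C + D)       ≡⟨ square C D ⟩
    suc c * suc c                                 ≤⟨ *-mono-≤ (n<2^n c) (n<2^n c) ⟩
    2 ^ c * 2 ^ c                                 ≡⟨ ^-distribˡ-+-* 2 c c ⟨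
    2 ^ t                                         ∎
    where
    square : ∀ C D → suc (C + ((C + 2 * D) + (C + 2 * D) + 3) * D) + ((C + 2 * D) * C + C + D)
                   ≡ suc (C + 2 * D) * suc (C + 2 * D)
    square = solve-∀
  ^-cancelʳ-≤ : ∀ b → 1 < b → ∀ {m n} → b ^ m ≤ b ^ n → m ≤ n
  ^-cancelʳ-≤ b 1<b {m} {n} le with m ≤? n
  ... | yes m≤n = m≤n
  ... | no m≰n = ⊥-elim (<⇒≱ (^-monoʳ-< b 1<b (≰⇒> m≰n)) le)

-- 11³ (n + 10) ≤ 2 · 10³ (n + 7) keeps the bound alive from n to n + 3.
[11/10]^n-bound : ∀ n → 11 ^ n * (n + 7) ≤ 11 * 10 ^ n * 2 ^ third n
[11/10]^n-bound 0 = m≤m+n 7 4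
[11/10]^n-bound 1 = m≤m+n 88 22
[11/10]^n-bound 2 = m≤m+n 1089 11
[11/10]^n-bound (suc (suc (suc n))) = begin
  11 ^ (3 + n) * (3 + n + 7)                             ≤⟨ m≤m+n _ (11 ^ n * (669 * n + 690)) ⟩
  11 ^ (3 + n) * (3 + n + 7) + 11 ^ n * (669 * n + 690)  ≡⟨ left (11 ^ n) n ⟩
  2000 * (11 ^ n * (n + 7))                              ≤⟨ *-monoʳ-≤ 2000 ([11/10]^n-bound n) ⟩
  2000 * (11 * 10 ^ n * 2 ^ third n)                     ≡⟨ right (10 ^ n) (2 ^ third n) ⟩
  11 * 10 ^ (3 + n) * 2 ^ suc (third n)                  ∎
  where
  open ≤-Reasoning
  left : ∀ x n → 11 * (11 * (11 * x)) * (3 + n + 7) + x * (669 * n + 690) ≡ 2000 * (x * (n + 7))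
  left = solve-∀
  right : ∀ y z → 2000 * (11 * y * z) ≡ 11 * (10 * (10 * (10 * y))) * (2 * z)
  right = solve-∀

module Growth (em : ExcludedMiddle (lsuc lzero)) (T : Tournament) (cd : ∀ n → Coding T n) where
  open Counting em T

  -- With its mark, a code of 3 m vertices has size 3 m + 1. A polynomial bound on the profile,
  -- multiplied by the number of places for the mark, would bound 2 ^ m.
  ¬polyBounded : ¬ PolyBounded T
  ¬polyBounded (C , d , h) = exponential-beats-polynomial C (suc d) λ m → bound m
    where
    bound : ∀ m → 2 ^ m ≤ C * (2 + m * 3) ^ suc d
    bound m with coding⇒many (cd (m * 3))
    ... | k , le , many = begin
      2 ^ m                                         ≡⟨ cong (2 ^_) (third[m*3] m) ⟨
      2 ^ third (m * 3)                             ≤⟨ le ⟩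
      k * suc (m * 3)                               ≤⟨ *-mono-≤ (profile-pigeonhole {T} many (h (suc (m * 3)))) (n≤1+n _) ⟩
      C * (2 + m * 3) ^ d * (2 + m * 3)             ≡⟨ *-assoc C _ _ ⟩
      C * ((2 + m * 3) ^ d * (2 + m * 3))           ≡⟨ cong (C *_) (*-comm ((2 + m * 3) ^ d) _) ⟩
      C * (2 + m * 3) ^ suc d                       ∎
      where open ≤-Reasoning

  expGrowth : ExpGrowth T
  -- Here c = 11/10 and a = 1/13. As (11/10)³ < 2, the growth of 2 ^ `third n` also absorbs the
  -- factor n + 1 lost to the mark.
  expGrowth = 11 , 10 , 1 , 13 , s≤s z≤n , ≤-refl , ≤-refl , s≤s z≤n , at-least
    where
    empty : Fin 1 → FinTour 0
    empty _ = (λ ()) , record { irrefl = λ () ; antisym = λ () ; complete = λ () }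
    at-least : ∀ n → Σ ℕ λ k → (1 * 11 ^ n ≤ 13 * 10 ^ n * k) × ProfileAtLeast T n k
    -- A marked code is never empty, so size 0 is settled by the empty tournament.
    at-least zero = 1 , s≤s z≤n , empty , (λ _ → (λ ()) , (λ { {()} }) , λ ()) ,
      λ { zero zero ne → ⊥-elim (ne refl) }
    at-least (suc n) with coding⇒many (cd n)
    ... | k , le , many = k , *-cancelʳ-≤ _ _ (suc n) bound , many
      where
      open ≤-Reasoning
      bound : 1 * 11 ^ suc n * suc n ≤ 13 * 10 ^ suc n * k * suc n
      bound = begin
        -- Adding 66 turns 11 (n + 1) into 11 (n + 7), the weight in the estimate; further down, 121
        -- + 9 = 13 * 10 yields the constant 13.
        1 * 11 ^ suc n * suc n                    ≤⟨ m≤m+n _ (66 * 11 ^ n) ⟩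
        1 * 11 ^ suc n * suc n + 66 * 11 ^ n      ≡⟨ left (11 ^ n) n ⟩
        11 * (11 ^ n * (n + 7))                   ≤⟨ *-monoʳ-≤ 11 ([11/10]^n-bound n) ⟩
        11 * (11 * 10 ^ n * 2 ^ third n)          ≤⟨ *-monoʳ-≤ 11 (*-monoʳ-≤ (11 * 10 ^ n) le) ⟩
        11 * (11 * 10 ^ n * (k * suc n))          ≤⟨ m≤m+n _ (9 * 10 ^ n * (k * suc n)) ⟩
        11 * (11 * 10 ^ n * (k * suc n)) + 9 * 10 ^ n * (k * suc n) ≡⟨ right (10 ^ n) k n ⟩
        13 * 10 ^ suc n * k * suc n               ∎
        where
        left : ∀ x n → 1 * (11 * x) * suc n + 66 * x ≡ 11 * (x * (n + 7))
        left = solve-∀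
        right : ∀ y k n → 11 * (11 * y * (k * suc n)) + 9 * y * (k * suc n) ≡ 13 * (10 * y) * k * suc n
        right = solve-∀

-- Three constructions of codings

true-or-false : ∀ s → s ≡ true ⊎ s ≡ false
true-or-false true  = inj₁ refl
true-or-false false = inj₂ refl

true-iff : ∀ {s t} → (s ≡ true → t ≡ true) → (t ≡ true → s ≡ true) → s ≡ t
true-iff {true}  f g = sym (f refl)
true-iff {false} {true}  f g = g refl
true-iff {false} {false} f g = refl

-- A bijection that preserves c and is increasing on each class of c moves no least element, hence nothing.
class-increasing⇒identity : ∀ {n} {R S : Fin n → Fin n → Set} (e : R ≃ S) (c : Fin n → Bool) →
  (∀ i → c (to e i) ≡ c i) → (∀ i j → i F.< j → c i ≡ c j → to e i F.< to e j) → ∀ i → to e i ≡ i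
class-increasing⇒identity {n} e c c-to mono i = below (suc (toℕ i)) i ≤-refl
  where
  below : ∀ m (i : Fin n) → toℕ i < m → to e i ≡ i
  below (suc m) i (s≤s i≤m) with FP.<-cmp (to e i) i
  ... | tri≈ _ eq _ = eq
  ... | tri< lt _ _ = to-injective e (below m (to e i) (≤-trans lt i≤m))
  ... | tri> _ _ gt with FP.<-cmp (from e i) i
  ...   | tri< lt _ _ = trans (sym (cong (to e) (trans (sym (below m (from e i) (≤-trans lt i≤m))) (to-from e i)))) (to-from e i)
  ...   | tri≈ _ eq _ = trans (cong (to e) (sym eq)) (to-from e i)
  ...   | tri> _ _ i<j = ⊥-elim (FP.<-asym gt (subst (to e i F.<_) (to-from e i)
            (mono i (from e i) i<j (trans (cong c (sym (to-from e i))) (c-to (from e i))))))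

-- The positions before v are injected into those before w. This serves to compare numbers of
-- predecessors.
prefix-≤ : ∀ {n} (f : Fin n → Fin n) → Injective _≡_ _≡_ f → (v w : Fin n) →
           (∀ i → i F.< v → f i F.< w) → toℕ v ≤ toℕ w
prefix-≤ {n} f inj v w h = FP.injective⇒≤ {f = g} g-injective
  where
  lift-i : Fin (toℕ v) → Fin n
  lift-i i = F.inject≤ i (<⇒≤ (FP.toℕ<n v))
  lt : ∀ i → f (lift-i i) F.< w
  lt i = h _ (subst (_< toℕ v) (sym (FP.toℕ-inject≤ i _)) (FP.toℕ<n i))
  g : Fin (toℕ v) → Fin (toℕ w)
  g i = F.fromℕ< (lt i)
  g-injective : Injective _≡_ _≡_ g
  g-injective {i} {j} eq = FP.inject≤-injective _ _ i j
    (inj (FP.toℕ-injective (FP.fromℕ<-injective _ _ (lt i) (lt j) eq)))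

split₃ : ℕ → ℕ × Fin 3
split₃ 0 = 0 , zero
split₃ 1 = 0 , suc zero
split₃ 2 = 0 , suc (suc zero)
split₃ (suc (suc (suc j))) = suc (proj₁ (split₃ j)) , proj₂ (split₃ j)

block : ℕ → ℕ
block j = proj₁ (split₃ j)

offset : ℕ → Fin 3
offset j = proj₂ (split₃ j)

split₃-join : ∀ b ρ → split₃ (b * 3 + toℕ ρ) ≡ (b , ρ)
split₃-join zero    zero             = refl
split₃-join zero    (suc zero)       = refl
split₃-join zero    (suc (suc zero)) = refl
split₃-join (suc b) ρ = cong (λ (c , σ) → suc c , σ) (split₃-join b ρ)

join-split₃ : ∀ j → block j * 3 + toℕ (offset j) ≡ j
join-split₃ 0 = refl
join-split₃ 1 = refl
join-split₃ 2 = refl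
join-split₃ (suc (suc (suc j))) = cong (3 +_) (join-split₃ j)

<-split₃ : ∀ i j → i < j → block i < block j ⊎ (block i ≡ block j × offset i F.< offset j)
<-split₃ i j i<j with <-cmp (block i) (block j)
... | tri< lt _ _ = inj₁ lt
... | tri≈ _ eq _ = inj₂ (eq , +-cancelˡ-< (block i * 3) _ _
        (subst₂ _<_ (sym (join-split₃ i)) (trans (sym (join-split₃ j)) (cong (λ b → b * 3 + toℕ (offset j)) (sym eq))) i<j))
... | tri> _ _ gt = ⊥-elim (<-asym i<j (subst₂ _<_ (join-split₃ j) (join-split₃ i) (begin-strict
        block j * 3 + toℕ (offset j)  <⟨ +-monoʳ-< (block j * 3) (FP.toℕ<n (offset j)) ⟩
        block j * 3 + 3               ≡⟨ +-comm (block j * 3) 3 ⟩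
        suc (block j) * 3             ≤⟨ *-monoˡ-≤ 3 gt ⟩
        block i * 3                   ≤⟨ m≤m+n _ _ ⟩
        block i * 3 + toℕ (offset i)  ∎)))
  where open ≤-Reasoning

module Codings (T : Tournament) where
  open Arcs T

  Fwd Bwd Orient : (ℕ → X) → (ℕ → X) → Set
  Fwd a b = Uniform (λ i j → a i ⟶ b j)
  Bwd a b = Uniform (λ i j → b j ⟶ a i)
  Orient a b = Fwd a b ⊎ Bwd a b

  adjacent : ∀ {a} → Orient a a → ∀ {i j} → i ≢ j → a i ⟶ a j ⊎ a j ⟶ a i
  adjacent o {i} {j} i≢j with <-cmp i j
  ... | tri< lt _ _ = Sum.map (λ f → f i j lt) (λ f → f i j lt) o
  ... | tri≈ _ eq _ = ⊥-elim (i≢j eq)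
  ... | tri> _ _ gt = Sum.swap (Sum.map (λ f → f j i gt) (λ f → f j i gt) o)

  adjacent⇒injective : ∀ {n} (p : Fin n → X) → (∀ i j → i F.< j → p i ⟶ p j ⊎ p j ⟶ p i) → Injective _≡_ _≡_ p
  adjacent⇒injective p adj {i} {j} eq with FP.<-cmp i j
  ... | tri< lt _ _ = ⊥-elim ([ (λ r → ⟶⇒≢ r eq) , (λ r → ⟶⇒≢ r (sym eq)) ] (adj i j lt))
  ... | tri≈ _ e _  = e
  ... | tri> _ _ gt = ⊥-elim ([ (λ r → ⟶⇒≢ r (sym eq)) , (λ r → ⟶⇒≢ r eq) ] (adj j i gt))

  module _ {n} {p p′ : Fin n → X} (e : Induced T p ≃ Induced T p′) where

    -- If the images came in the opposite order, `back` would supply the reverse of the transported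
    -- arc.
    fwd-increasing : ∀ {i j} → p i ⟶ p j → (to e j F.< to e i → p′ (to e j) ⟶ p′ (to e i)) → to e i F.< to e j
    fwd-increasing {i} {j} r back with FP.<-cmp (to e i) (to e j)
    ... | tri< lt _ _ = lt
    ... | tri≈ _ eq _ = ⊥-elim (⟶⇒≢ (arc e r) (cong p′ eq))
    ... | tri> _ _ gt = ⊥-elim (antisym _ _ (arc e r) (back gt))

    bwd-increasing : ∀ {i j} → p j ⟶ p i → (to e j F.< to e i → p′ (to e i) ⟶ p′ (to e j)) → to e i F.< to e j
    bwd-increasing {i} {j} r back with FP.<-cmp (to e i) (to e j)
    ... | tri< lt _ _ = lt
    ... | tri≈ _ eq _ = ⊥-elim (⟶⇒≢ (arc e r) (cong p′ (sym eq)))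
    ... | tri> _ _ gt = ⊥-elim (antisym _ _ (arc e r) (back gt))

  -- Each position carries one vertex. The mark v tells the letters apart, and then every arc tells the order of its ends.
  module _ (L : Bool → ℕ → X) (v : X) (in-v : ∀ i → L true i ⟶ v) (out-v : ∀ i → v ⟶ L false i)
           (orient : ∀ s t → (Fwd (L s) (L t) × Fwd (L t) (L s)) ⊎ (Bwd (L s) (L t) × Bwd (L t) (L s))) where

    two-letter-coding : ∀ n → Coding T n
    two-letter-coding n = record
      { mark = v ; code = p
      ; injective = λ u → adjacent⇒injective (p u) λ i j lt → Sum.map (λ f → proj₁ f _ _ lt) (λ f → proj₁ f _ _ lt) (orient _ _)
      ; unmarked = λ u i → unmarked (u (toℕ i))
      ; decode = decode }
      where
      p : (ℕ → Bool) → Fin n → X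
      p u i = L (u (toℕ i)) (toℕ i)
      unmarked : ∀ s {i} → v ≢ L s i
      unmarked true  eq = ⟶⇒≢ (in-v _) (sym eq)
      unmarked false eq = ⟶⇒≢ (out-v _) eq
      same-letter : ∀ s t {i j} → (v ⟶ L s i → v ⟶ L t j) → (L s i ⟶ v → L t j ⟶ v) → s ≡ t
      same-letter true  true  _   _   = refl
      same-letter false false _   _   = refl
      same-letter true  false _   inn = ⊥-elim (antisym _ _ (out-v _) (inn (in-v _)))
      same-letter false true  out _   = ⊥-elim (antisym _ _ (in-v _) (out (out-v _)))
      decode : ∀ u u′ (e : Induced T (p u) ≃ Induced T (p u′)) → (∀ i → v ⟶ p u i → v ⟶ p u′ (to e i)) →
               (∀ i → p u i ⟶ v → p u′ (to e i) ⟶ v) → ∀ b → suc b * 3 ≤ n → u b ≡ u′ b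
      -- With a single class, e is increasing and hence the identity, so position b carries the same
      -- letter in both words.
      decode u u′ e out inn b 3b≤n = subst (λ b → u b ≡ u′ b) (FP.toℕ-fromℕ< b<n)
          (trans (letter i) (cong (u′ ∘ toℕ) (class-increasing⇒identity e (λ _ → true) (λ _ → refl) (λ i j lt _ → increasing i j lt) i)))
        where
        b<n : b < n
        b<n = ≤-trans (m≤m*n (suc b) 3) 3b≤n
        i : Fin n
        i = F.fromℕ< b<n
        letter : ∀ i → u (toℕ i) ≡ u′ (toℕ (to e i))
        letter i = same-letter _ _ (out i) (inn i)
        increasing : ∀ i j → i F.< j → to e i F.< to e j
        increasing i j lt with orient (u (toℕ i)) (u (toℕ j))
        ... | inj₁ (f , g) = fwd-increasing e (f _ _ lt) (λ gt →
                subst₂ (λ s t → L s (toℕ (to e j)) ⟶ L t (toℕ (to e i))) (letter j) (letter i) (g _ _ gt))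
        ... | inj₂ (f , g) = bwd-increasing e (f _ _ lt) (λ gt →
                subst₂ (λ s t → L t (toℕ (to e i)) ⟶ L s (toℕ (to e j))) (letter j) (letter i) (g _ _ gt))

  -- In a block with letter `true`, offset ρ uses index `δ ρ` instead of ρ. The matching coding
  -- moves the second vertex to the index of the first; the cycle coding moves all three to one
  -- index.
  module Blocks (δ : Fin 3 → ℕ) (δ≤ : ∀ ρ → δ ρ ≤ toℕ ρ) where

    shift : Bool → Fin 3 → ℕ
    shift true  ρ = δ ρ
    shift false ρ = toℕ ρ

    shift≤ : ∀ s ρ → shift s ρ ≤ toℕ ρ
    shift≤ true  ρ = δ≤ ρ
    shift≤ false ρ = ≤-refl

    index : (ℕ → Bool) → ℕ → ℕ
    index u j = block j * 3 + shift (u (block j)) (offset j)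

    index≤ : ∀ u j → index u j ≤ j
    index≤ u j = ≤-trans (+-monoʳ-≤ (block j * 3) (shift≤ (u (block j)) (offset j))) (≤-reflexive (join-split₃ j))

    index-< : ∀ u i j → block i < block j → index u i < index u j
    index-< u i j lt = begin-strict
      index u i                   <⟨ +-monoʳ-< (block i * 3) (≤-<-trans (shift≤ (u (block i)) (offset i)) (FP.toℕ<n (offset i))) ⟩
      block i * 3 + 3             ≡⟨ +-comm (block i * 3) 3 ⟩
      suc (block i) * 3           ≤⟨ *-monoˡ-≤ 3 lt ⟩
      block j * 3                 ≤⟨ m≤m+n _ _ ⟩
      index u j                   ∎
      where open ≤-Reasoning

    module _ {n : ℕ} (b : ℕ) (3b≤n : suc b * 3 ≤ n) where

      bound : ∀ ρ → b * 3 + toℕ ρ < n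
      bound ρ = ≤-trans (+-monoʳ-< (b * 3) (FP.toℕ<n ρ)) (≤-trans (≤-reflexive (+-comm (b * 3) 3)) 3b≤n)

      position : Fin 3 → Fin n
      position ρ = F.fromℕ< (bound ρ)

      toℕ-position : ∀ ρ → toℕ (position ρ) ≡ b * 3 + toℕ ρ
      toℕ-position ρ = FP.toℕ-fromℕ< (bound ρ)

      split-position : ∀ ρ → split₃ (toℕ (position ρ)) ≡ (b , ρ)
      split-position ρ = trans (cong split₃ (toℕ-position ρ)) (split₃-join b ρ)

      letter-position : (A : Fin 3 → ℕ → X) (u : ℕ → Bool) (ρ : Fin 3) →
                        A (offset (toℕ (position ρ))) (index u (toℕ (position ρ))) ≡ A ρ (b * 3 + shift (u b) ρ)
      letter-position A u ρ = cong (λ (c , σ) → A σ (c * 3 + shift (u c) σ)) (split-position ρ)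

  -- A block consists of B false, B true, B false; u decides whether its second vertex is matched with its first by a
  -- reversed arc. The mark tells the sequences B true and B false apart, and the order on each of them is visible.
  module _ (B : Bool → ℕ → X) (orient : ∀ s → Orient (B s) (B s))
           (generic : ∀ {i j} → i ≢ j → B false i ⟶ B true j) (reversed : ∀ i → B true i ⟶ B false i)
           (v : ℕ → X) (in-v : ∀ n i → i < n → B false i ⟶ v n) (out-v : ∀ n i → i < n → v n ⟶ B true i) where

    private
      δ : Fin 3 → ℕ
      δ (suc (suc _)) = 2
      δ _             = 0
      δ≤ : ∀ ρ → δ ρ ≤ toℕ ρ
      δ≤ zero = z≤n
      δ≤ (suc zero) = z≤n
      δ≤ (suc (suc zero)) = ≤-refl
      open Blocks δ δ≤
      middle : Fin 3 → Bool
      middle (suc zero) = true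
      middle _          = false

    matching-coding : ∀ n → Coding T n
    matching-coding n = record
      { mark = v n ; code = p
      ; injective = λ u → adjacent⇒injective (p u) (adj u)
      ; unmarked = λ u i → unmarked _ (<-bound u i)
      ; decode = decode }
      where
      c : Fin n → Bool
      c i = middle (offset (toℕ i))
      p : (ℕ → Bool) → Fin n → X
      p u i = B (c i) (index u (toℕ i))
      <-bound : ∀ u i → index u (toℕ i) < n
      <-bound u i = ≤-<-trans (index≤ u (toℕ i)) (FP.toℕ<n i)
      unmarked : ∀ s {i} → i < n → v n ≢ B s i
      unmarked true  lt eq = ⟶⇒≢ (out-v n _ lt) eq
      unmarked false lt eq = ⟶⇒≢ (in-v n _ lt) (sym eq)
      -- Only the first two vertices of a block can share an index, and they belong to different
      -- classes.
      index-increasing : ∀ u (i j : Fin n) → i F.< j → c i ≡ c j → index u (toℕ i) < index u (toℕ j)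
      index-increasing u i j lt eq with <-split₃ (toℕ i) (toℕ j) lt
      ... | inj₁ blt = index-< u (toℕ i) (toℕ j) blt
      ... | inj₂ (beq , olt) = subst (λ b → index u (toℕ i) < b * 3 + shift (u b) (offset (toℕ j))) beq
              (+-monoʳ-< (block (toℕ i) * 3) (within (u (block (toℕ i))) (offset (toℕ i)) (offset (toℕ j)) olt eq))
        where
        within : ∀ s ρ σ → ρ F.< σ → middle ρ ≡ middle σ → shift s ρ < shift s σ
        within true  zero (suc (suc zero)) _ _ = s≤s z≤n
        within false zero (suc (suc zero)) _ _ = s≤s z≤n
        within s zero (suc zero) _ ()
        within s (suc zero) (suc zero) (s≤s ()) _
        within s (suc (suc zero)) (suc zero) (s≤s ()) _
        within s (suc (suc zero)) (suc (suc zero)) (s≤s (s≤s ())) _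
      cross : ∀ i j → B false i ⟶ B true j ⊎ B true j ⟶ B false i
      cross i j with i ≟ j
      ... | yes refl = inj₂ (reversed i)
      ... | no i≢j   = inj₁ (generic i≢j)
      adj′ : ∀ s t {i j} → (s ≡ t → i < j) → B s i ⟶ B t j ⊎ B t j ⟶ B s i
      adj′ true  true  lt = adjacent (orient true) (<⇒≢ (lt refl))
      adj′ false false lt = adjacent (orient false) (<⇒≢ (lt refl))
      adj′ true  false lt = Sum.swap (cross _ _)
      adj′ false true  lt = cross _ _
      adj : ∀ u i j → i F.< j → p u i ⟶ p u j ⊎ p u j ⟶ p u i
      adj u i j lt = adj′ (c i) (c j) (index-increasing u i j lt)
      same-class : ∀ s t {i j} → i < n → j < n → (v n ⟶ B s i → v n ⟶ B t j) → (B s i ⟶ v n → B t j ⟶ v n) → t ≡ s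
      same-class true  true  _ _ _   _   = refl
      same-class false false _ _ _   _   = refl
      same-class true  false i j out _   = ⊥-elim (antisym _ _ (out (out-v n _ i)) (in-v n _ j))
      same-class false true  i j _   inn = ⊥-elim (antisym _ _ (inn (in-v n _ i)) (out-v n _ j))
      decode : ∀ u u′ (e : Induced T (p u) ≃ Induced T (p u′)) → (∀ i → v n ⟶ p u i → v n ⟶ p u′ (to e i)) →
               (∀ i → p u i ⟶ v n → p u′ (to e i) ⟶ v n) → ∀ b → suc b * 3 ≤ n → u b ≡ u′ b
      -- Once e is known to be the identity, the arc between the first two vertices of block b has
      -- the same direction in both codes, and this direction is the letter.
      decode u u′ e out inn b 3b≤n = true-iff
          (λ h → matched u′ (subst₂ (λ i j → p u′ i ⟶ p u′ j) (fixed one) (fixed nil) (arc e (matched⁻ u h))))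
          (λ h → matched u (arc⁻ e (subst₂ (λ i j → p u′ i ⟶ p u′ j) (sym (fixed one)) (sym (fixed nil)) (matched⁻ u′ h))))
        where
        class : ∀ i → c (to e i) ≡ c i
        class i = same-class (c i) (c (to e i)) (<-bound u i) (<-bound u′ (to e i)) (out i) (inn i)
        increasing : ∀ i j → i F.< j → c i ≡ c j → to e i F.< to e j
        increasing i j lt eq with orient (c i)
        ... | inj₁ f = fwd-increasing e {i} {j} (subst (λ s → p u i ⟶ B s (index u (toℕ j))) eq (f _ _ (index-increasing u i j lt eq)))
                λ gt → subst₂ (λ s t → B s (index u′ (toℕ (to e j))) ⟶ B t (index u′ (toℕ (to e i)))) (trans eq (sym (class j))) (sym (class i))
                         (f _ _ (index-increasing u′ (to e j) (to e i) gt (trans (class j) (trans (sym eq) (sym (class i))))))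
        ... | inj₂ f = bwd-increasing e {i} {j} (subst (λ s → B s (index u (toℕ j)) ⟶ p u i) eq (f _ _ (index-increasing u i j lt eq)))
                λ gt → subst₂ (λ s t → B t (index u′ (toℕ (to e i))) ⟶ B s (index u′ (toℕ (to e j)))) (trans eq (sym (class j))) (sym (class i))
                         (f _ _ (index-increasing u′ (to e j) (to e i) gt (trans (class j) (trans (sym eq) (sym (class i))))))
        fixed : ∀ i → to e i ≡ i
        fixed = class-increasing⇒identity e c class increasing
        nil one : Fin n
        nil = position b 3b≤n zero
        one = position b 3b≤n (suc zero)
        letter : ∀ u ρ → p u (position b 3b≤n ρ) ≡ B (middle ρ) (b * 3 + shift (u b) ρ)
        letter u ρ = letter-position b 3b≤n (B ∘ middle) u ρ
        reversed⇒true : ∀ s → B true (b * 3 + shift s (suc zero)) ⟶ B false (b * 3 + shift s zero) → s ≡ true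
        reversed⇒true true  _ = refl
        reversed⇒true false r = ⊥-elim (antisym _ _ r (generic (λ eq → 0≢1+n (+-cancelˡ-≡ (b * 3) 0 1 eq))))
        true⇒reversed : ∀ s → s ≡ true → B true (b * 3 + shift s (suc zero)) ⟶ B false (b * 3 + shift s zero)
        true⇒reversed true _ = reversed _
        matched : ∀ u → p u one ⟶ p u nil → u b ≡ true
        matched u r = reversed⇒true (u b) (subst₂ _⟶_ (letter u (suc zero)) (letter u zero) r)
        matched⁻ : ∀ u → u b ≡ true → p u one ⟶ p u nil
        matched⁻ u h = subst₂ _⟶_ (sym (letter u (suc zero))) (sym (letter u zero)) (true⇒reversed (u b) h)

  -- The blocks are 3-cycles or chains; u b = false iff position 3 b is a cut, i.e. all its predecessors dominate all its
  -- successors. The mark plays no role, since a cut is recognised by its number of predecessors.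
  module _ (A : Fin 3 → ℕ → X) (fwd : ∀ α β → Fwd (A α) (A β))
           (cycle : ∀ i → Cycle (A zero i) (A (suc zero) i) (A (suc (suc zero)) i)) where

    open Blocks (λ _ → 0) (λ _ → z≤n)

    cycle-coding : ∀ n → Coding T n
    cycle-coding n = record
      { mark = A zero 0 ; code = p
      ; injective = λ u → adjacent⇒injective (p u) (λ i j lt → [ inj₁ , (λ (_ , _ , _ , r) → inj₂ r) ] (arcs u i j lt))
      ; unmarked = λ u i → ⟶⇒≢ (fwd _ _ _ _ (s≤s z≤n))
      ; decode = λ u u′ e _ _ b 3b≤n → true-iff (decode u u′ e b 3b≤n) (decode u′ u (≃-sym e) b 3b≤n) }
      where
      p : (ℕ → Bool) → Fin n → X
      -- The indices are raised by one because the mark has index 0.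
      p u i = A (offset (toℕ i)) (suc (index u (toℕ i)))
      blk : Fin n → ℕ
      blk i = block (toℕ i)
      blocks : ∀ u i j → blk i < blk j → p u i ⟶ p u j
      blocks u i j lt = fwd _ _ _ _ (s≤s (index-< u (toℕ i) (toℕ j) lt))
      chain : ∀ u i j → blk i ≡ blk j → u (blk i) ≡ false → offset (toℕ i) F.< offset (toℕ j) → p u i ⟶ p u j
      chain u i j beq false! lt = fwd _ _ _ _ (s≤s (subst₂ _<_
          (cong (λ s → blk i * 3 + shift s (offset (toℕ i))) (sym false!))
          (cong₂ (λ b s → b * 3 + shift s (offset (toℕ j))) beq (trans (sym false!) (cong u beq)))
          (+-monoʳ-< (blk i * 3) lt)))
      letter : ∀ u i {b ρ} → split₃ (toℕ i) ≡ (b , ρ) → u b ≡ true → p u i ≡ A ρ (suc (b * 3 + 0))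
      letter u i {b} {ρ} eq true! = trans (cong (λ (c , σ) → A σ (suc (c * 3 + shift (u c) σ))) eq)
                                          (cong (λ s → A ρ (suc (b * 3 + shift s ρ))) true!)
      inside-cycle : ∀ u i j {b ρ σ} → split₃ (toℕ i) ≡ (b , ρ) → split₃ (toℕ j) ≡ (b , σ) → u b ≡ true → ρ F.< σ →
        p u i ⟶ p u j ⊎ Σ (Fin n) λ m → p u i ⟶ p u m × p u m ⟶ p u j × p u j ⟶ p u i
      inside-cycle u i j {b} {ρ} {σ} iρ jσ true! lt = go ρ σ lt iρ jσ
        where
        Result : Set
        Result = p u i ⟶ p u j ⊎ Σ (Fin n) λ m → p u i ⟶ p u m × p u m ⟶ p u j × p u j ⟶ p u i
        edge : ∀ k l {ρ σ} → split₃ (toℕ k) ≡ (b , ρ) → split₃ (toℕ l) ≡ (b , σ) →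
               A ρ (suc (b * 3 + 0)) ⟶ A σ (suc (b * 3 + 0)) → p u k ⟶ p u l
        edge k l kρ lσ r = subst₂ _⟶_ (sym (letter u k kρ true!)) (sym (letter u l lσ true!)) r
        go : ∀ ρ σ → ρ F.< σ → split₃ (toℕ i) ≡ (b , ρ) → split₃ (toℕ j) ≡ (b , σ) → Result
        go zero       (suc zero)       _ iρ jσ = inj₁ (edge i j iρ jσ (proj₁ (cycle _)))
        go (suc zero) (suc (suc zero)) _ iρ jσ = inj₁ (edge i j iρ jσ (proj₁ (proj₂ (cycle _))))
        go zero       (suc (suc zero)) _ iρ jσ = inj₂ (m , edge i m iρ mρ (proj₁ (cycle _)) ,
            edge m j mρ jσ (proj₁ (proj₂ (cycle _))) , edge j i jσ iρ (proj₂ (proj₂ (cycle _))))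
          where
          -- j is the last vertex of its block, so the whole block, including its second vertex m,
          -- lies below n.
          3b≤n : suc b * 3 ≤ n
          3b≤n = ≤-trans (≤-reflexive (trans (+-comm 3 (b * 3)) (trans (+-suc (b * 3) 2) (cong suc
                   (trans (cong (λ (c , σ) → c * 3 + toℕ σ) (sym jσ)) (join-split₃ (toℕ j))))))) (FP.toℕ<n j)
          m : Fin n
          m = position b 3b≤n (suc zero)
          mρ : split₃ (toℕ m) ≡ (b , suc zero)
          mρ = split-position b 3b≤n (suc zero)
        go (suc zero) (suc zero) (s≤s ())
        go (suc (suc zero)) (suc zero) (s≤s ())
        go (suc (suc zero)) (suc (suc zero)) (s≤s (s≤s ()))
      -- The only backward arcs go from the third to the first vertex of a cycle; they come with the
      -- second vertex.
      arcs : ∀ u i j → i F.< j → p u i ⟶ p u j ⊎ Σ (Fin n) λ m → p u i ⟶ p u m × p u m ⟶ p u j × p u j ⟶ p u i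
      arcs u i j lt with <-split₃ (toℕ i) (toℕ j) lt
      ... | inj₁ blt = inj₁ (blocks u i j blt)
      ... | inj₂ (beq , olt) with true-or-false (u (blk i))
      ...   | inj₁ true!  = inside-cycle u i j refl (cong (_, offset (toℕ j)) (sym beq)) true! olt
      ...   | inj₂ false! = inj₁ (chain u i j beq false! olt)
      decode : ∀ u u′ (e : Induced T (p u) ≃ Induced T (p u′)) → ∀ b → suc b * 3 ≤ n → u b ≡ true → u′ b ≡ true
      decode u u′ e b 3b≤n ub with true-or-false (u′ b)
      ... | inj₁ true!  = true!
      -- The first vertex w of block b is a cut in the code of u′, so its preimage v is one in the
      -- code of u. Equal numbers of predecessors give v = w, yet in the code of u this vertex
      -- begins a 3-cycle and is dominated by the last vertex of its block.
      ... | inj₂ false! = ⊥-elim (antisym _ _ v⟶last last⟶v)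
        where
        w v last : Fin n
        w    = position b 3b≤n zero
        v    = from e w
        last = position b 3b≤n (suc (suc zero))
        split-w : split₃ (toℕ w) ≡ (b , zero)
        split-w = split-position b 3b≤n zero
        below : ∀ x → x F.< w → blk x < b
        below x lt with <-split₃ (toℕ x) (toℕ w) lt
        ... | inj₁ blt = subst (blk x <_) (cong proj₁ split-w) blt
        ... | inj₂ (_ , olt) = ⊥-elim (n≮0 (subst (λ (_ , σ) → offset (toℕ x) F.< σ) split-w olt))
        above : ∀ x → w F.< x → b ≤ blk x
        above x lt with <-split₃ (toℕ w) (toℕ x) lt
        ... | inj₁ blt = <⇒≤ (subst (_< blk x) (cong proj₁ split-w) blt)
        ... | inj₂ (beq , _) = ≤-reflexive (trans (sym (cong proj₁ split-w)) beq)
        into-w : ∀ x → x F.< w → p u′ x ⟶ p u′ w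
        into-w x lt = blocks u′ x w (subst (blk x <_) (sym (cong proj₁ split-w)) (below x lt))
        from-w : ∀ x → w F.< x → p u′ w ⟶ p u′ x
        from-w x lt with <-split₃ (toℕ w) (toℕ x) lt
        ... | inj₁ blt = blocks u′ w x blt
        ... | inj₂ (beq , olt) = chain u′ w x beq (trans (cong u′ (cong proj₁ split-w)) false!) olt
        before-w : ∀ x → p u′ x ⟶ p u′ w → x F.< w
        before-w x r with FP.<-cmp x w
        ... | tri< lt _ _ = lt
        ... | tri≈ _ eq _ = ⊥-elim (⟶⇒≢ r (cong (p u′) eq))
        ... | tri> _ _ gt = ⊥-elim (antisym _ _ r (from-w x gt))
        after-w : ∀ x → p u′ w ⟶ p u′ x → w F.< x
        after-w x r with FP.<-cmp x w
        ... | tri< lt _ _ = ⊥-elim (antisym _ _ r (into-w x lt))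
        ... | tri≈ _ eq _ = ⊥-elim (⟶⇒≢ r (cong (p u′) (sym eq)))
        ... | tri> _ _ gt = gt
        to-v : to e v ≡ w
        to-v = to-from e w
        cut : ∀ i j → p u i ⟶ p u v → p u v ⟶ p u j → p u i ⟶ p u j
        cut i j r s = arc⁻ e (blocks u′ (to e i) (to e j) (≤-trans
          (below (to e i) (before-w (to e i) (subst (λ z → p u′ (to e i) ⟶ p u′ z) to-v (arc e r))))
          (above (to e j) (after-w (to e j) (subst (λ z → p u′ z ⟶ p u′ (to e j)) to-v (arc e s))))))
        -- A backward arc v → i would come with m such that i → m → v; but m → v → i forces m → i,
        -- by `cut`.
        into-v : ∀ i → i F.< v → p u i ⟶ p u v
        into-v i lt with arcs u i v lt
        ... | inj₁ r = r
        ... | inj₂ (m , im , mv , vi) = ⊥-elim (antisym _ _ im (cut m i mv vi))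
        from-v : ∀ j → v F.< j → p u v ⟶ p u j
        from-v j lt with arcs u v j lt
        ... | inj₁ r = r
        ... | inj₂ (m , vm , mj , jv) = ⊥-elim (antisym _ _ mj (cut j m jv vm))
        before-v : ∀ i → p u i ⟶ p u v → i F.< v
        before-v i r with FP.<-cmp i v
        ... | tri< lt _ _ = lt
        ... | tri≈ _ eq _ = ⊥-elim (⟶⇒≢ r (cong (p u) eq))
        ... | tri> _ _ gt = ⊥-elim (antisym _ _ r (from-v i gt))
        v≡w : v ≡ w
        v≡w = FP.toℕ-injective (≤-antisym
          (prefix-≤ (to e) (to-injective e) v w λ i lt →
            before-w _ (subst (λ z → p u′ (to e i) ⟶ p u′ z) to-v (arc e (into-v i lt))))
          (prefix-≤ (from e) (to-injective (≃-sym e)) w v λ i lt →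
            before-v _ (arc e⁻ (into-w i lt))))
          where e⁻ = ≃-sym e
        v⟶last : p u v ⟶ p u last
        v⟶last = from-v last (subst (F._< last) (sym v≡w)
          (subst₂ _<_ (sym (toℕ-position b 3b≤n zero)) (sym (toℕ-position b 3b≤n (suc (suc zero)))) (+-monoʳ-< (b * 3) (s≤s z≤n))))
        last⟶v : p u last ⟶ p u v
        last⟶v = subst₂ _⟶_ (sym (letter u last (split-position b 3b≤n _) ub))
          (sym (trans (cong (p u) v≡w) (letter u w split-w ub))) (proj₂ (proj₂ (cycle _)))

-- Homogeneous sequences in tournaments without codings

flip-~ : ∀ T {x y} → Arcs._~_ (flip-tournament T) x y → Arcs._~_ T x y
flip-~ T (M , am , mx , my) = M , record
  { homogeneous = homogeneous⁻ am
  ; no-cycle    = λ mx my mz (xy , yz , zx) → no-cycle am mx mz my (zx , yz , xy) } , mx , my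
  where open Arcs (flip-tournament T)

double : ℕ → ℕ
double zero    = zero
double (suc i) = suc (suc (double i))

double-< : ∀ {i j} → i < j → suc (double i) < double j
double-< {zero}  {suc j} _         = s≤s (s≤s z≤n)
double-< {suc i} {suc j} (s≤s i<j) = s≤s (s≤s (double-< i<j))

0<1 : 0 < 1
0<1 = s≤s z≤n

0<2 : 0 < 2
0<2 = s≤s z≤n

1<2 : 1 < 2
1<2 = s≤s (s≤s z≤n)

module Homogeneous (T : Tournament) (¬coding : ¬ (∀ n → Coding T n)) where
  open Arcs T
  open Codings T
  module Flip = Codings (flip-tournament T)

  -- All arcs between different indices go forward; those between x i and y i are left open.
  record Chain (x y : ℕ → X) : Set where
    field
      xx : Fwd x x
      xy : Fwd x y
      yx : Fwd y x
      yy : Fwd y y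
  open Chain

  swap : ∀ {x y} → Chain x y → Chain y x
  swap c = record { xx = yy c ; xy = yx c ; yx = xy c ; yy = xx c }

  -- Off the diagonal, one sequence dominates the other completely.
  Below Above : (x z : ℕ → X) → Set
  Below x z = Fwd x z × Bwd z x
  Above x z = Bwd x z × Fwd z x

  -- The possible outcomes of Ramsey's theorem. Equality is among them, since for instance the third
  -- vertices of the cycles may all coincide.
  Hom : (a b : ℕ → X) → Set
  Hom a b = Fwd a b ⊎ Bwd a b ⊎ Uniform (λ i j → a i ≡ b j)

  orientable : ∀ {a} → Hom a a → ¬ Uniform (λ i j → a i ≡ a j) → Orient a a
  orientable (inj₁ f)         _  = inj₁ f
  orientable (inj₂ (inj₁ f))  _  = inj₂ f
  orientable (inj₂ (inj₂ eq)) ne = ⊥-elim (ne eq)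

  below-generic : ∀ {x z} → Below x z → ∀ {i j} → i ≢ j → x i ⟶ z j
  below-generic (f , b) {i} {j} i≢j with <-cmp i j
  ... | tri< lt _ _ = f i j lt
  ... | tri≈ _ eq _ = ⊥-elim (i≢j eq)
  ... | tri> _ _ gt = b j i gt

  above-generic : ∀ {x z} → Above x z → ∀ {i j} → i ≢ j → z i ⟶ x j
  above-generic (b , f) {i} {j} i≢j with <-cmp i j
  ... | tri< lt _ _ = f i j lt
  ... | tri≈ _ eq _ = ⊥-elim (i≢j eq)
  ... | tri> _ _ gt = b j i gt

  letters : (a b : ℕ → X) → Bool → ℕ → X
  letters a b true  i = b (suc i)
  letters a b false i = a (suc i)

  -- A vertex that separates the two halves of a chain serves as the mark of a two-letter code.
  split-chain : ∀ {a b} v → Chain a b → (∀ i → b (suc i) ⟶ v) → (∀ i → v ⟶ a (suc i)) → ⊥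
  split-chain {a} {b} v ch in-v out-v = ¬coding (two-letter-coding (letters a b) v in-v out-v λ s t → inj₁ (fwd s t , fwd t s))
    where
    fwd : ∀ s t → Fwd (letters a b s) (letters a b t)
    fwd true  true  i j lt = yy ch _ _ (s≤s lt)
    fwd true  false i j lt = yx ch _ _ (s≤s lt)
    fwd false true  i j lt = xy ch _ _ (s≤s lt)
    fwd false false i j lt = xx ch _ _ (s≤s lt)

  -- b 0 is dominated by every later b and dominates every later a, so it can be the mark.
  ¬interleaved-backward : ∀ {a b} → Fwd a a → Fwd a b → Fwd b a → Bwd b b → ⊥
  ¬interleaved-backward {a} {b} aa ab ba bb = ¬coding (two-letter-coding (letters a b) (b 0)
      (λ i → bb _ _ (s≤s z≤n)) (λ i → ba _ _ (s≤s z≤n)) orient)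
    where
    L = letters a b
    orient : ∀ s t → (Fwd (L s) (L t) × Fwd (L t) (L s)) ⊎ (Bwd (L s) (L t) × Bwd (L t) (L s))
    orient true  true  = inj₂ ((λ i j lt → bb _ _ (s≤s lt)) , (λ i j lt → bb _ _ (s≤s lt)))
    orient true  false = inj₁ ((λ i j lt → ba _ _ (s≤s lt)) , (λ i j lt → ab _ _ (s≤s lt)))
    orient false true  = inj₁ ((λ i j lt → ab _ _ (s≤s lt)) , (λ i j lt → ba _ _ (s≤s lt)))
    orient false false = inj₁ ((λ i j lt → aa _ _ (s≤s lt)) , (λ i j lt → aa _ _ (s≤s lt)))

  -- a 0 dominates every later a and is dominated by every later b, so it can be the mark.
  ¬backward-interleaved : ∀ {a b} → Fwd a a → Bwd a b → Bwd b a → Orient b b → ⊥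
  ¬backward-interleaved {a} {b} aa ab ba bb = ¬coding λ n → flip-coding (Flip.two-letter-coding (letters b a) (a 0)
      (λ i → aa _ _ (s≤s z≤n)) (λ i → ab _ _ (s≤s z≤n)) orient n)
    where
    L = letters b a
    orient : ∀ s t → (Bwd (L s) (L t) × Bwd (L t) (L s)) ⊎ (Fwd (L s) (L t) × Fwd (L t) (L s))
    orient true  true  = inj₂ ((λ i j lt → aa _ _ (s≤s lt)) , (λ i j lt → aa _ _ (s≤s lt)))
    orient true  false = inj₁ ((λ i j lt → ab _ _ (s≤s lt)) , (λ i j lt → ba _ _ (s≤s lt)))
    orient false true  = inj₁ ((λ i j lt → ba _ _ (s≤s lt)) , (λ i j lt → ab _ _ (s≤s lt)))
    orient false false = Sum.swap (Sum.map (λ f → (λ i j lt → f _ _ (s≤s lt)) , (λ i j lt → f _ _ (s≤s lt)))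
                                  (λ f → (λ i j lt → f _ _ (s≤s lt)) , (λ i j lt → f _ _ (s≤s lt))) bb)

  -- The diagonal arcs are a matching against the general direction. The mark x n is dominated by
  -- the earlier x and dominates the earlier z.
  ¬below-matching : ∀ {x z} → Fwd x x → Hom z z → Below x z → (∀ i → z i ⟶ x i) → ⊥
  ¬below-matching {x} {z} xx zz below zx = ¬coding (matching-coding B orient
      (below-generic {x} {z} below) zx x (λ n i lt → xx i n lt) (λ n i lt → below-generic {x} {z} below (<⇒≢ lt ∘ sym)))
    where
    B : Bool → ℕ → X
    B true  = z
    B false = x
    orient : ∀ s → Orient (B s) (B s)
    orient false = inj₁ xx
    orient true  = orientable zz λ eq → antisym _ _ (zx 0) (subst (x 0 ⟶_) (sym (eq 0 1 0<1)) (proj₁ below 0 1 0<1))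

  ¬above-matching : ∀ {x z} → Fwd x x → Hom z z → Above x z → (∀ i → x i ⟶ z i) → ⊥
  ¬above-matching {x} {z} xx zz above xz = ¬coding λ n → flip-coding (Flip.matching-coding B orient
      (λ ne → above-generic {x} {z} above (ne ∘ sym ∘ suc-injective)) (λ i → xz (suc i)) (λ _ → x 0)
      (λ n i lt → xx _ _ (s≤s z≤n)) (λ n i lt → above-generic {x} {z} above (λ ())) n)
    where
    B : Bool → ℕ → X
    B true  i = z (suc i)
    B false i = x (suc i)
    orient : ∀ s → Flip.Orient (B s) (B s)
    orient false = inj₂ λ i j lt → xx _ _ (s≤s lt)
    orient true  = Sum.map (λ f i j lt → f _ _ (s≤s lt)) (λ f i j lt → f _ _ (s≤s lt)) (Sum.swap
      (orientable zz λ eq → antisym _ _ (xz 0) (subst (_⟶ x 0) (sym (eq 0 1 0<1)) (proj₁ above 0 1 0<1))))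

  -- Equalities contradict the arcs; the other excluded combinations code words by
  -- `¬interleaved-backward` and `¬backward-interleaved`.
  compare : ∀ {x z} → Fwd x x → Hom x z → Hom z x → Hom z z → Chain x z ⊎ Below x z ⊎ Above x z
  compare {x} {z} xx (inj₂ (inj₂ eq)) zx zz =
    ⊥-elim (⟶⇒≢ (xx 0 1 0<1) (trans (eq 0 2 0<2) (sym (eq 1 2 1<2))))
  compare {x} {z} xx xz (inj₂ (inj₂ eq)) zz =
    ⊥-elim (⟶⇒≢ (xx 1 2 1<2) (trans (sym (eq 0 1 0<1)) (eq 0 2 0<2)))
  compare xx (inj₁ xz) (inj₂ (inj₁ zx)) zz = inj₂ (inj₁ (xz , zx))
  compare xx (inj₂ (inj₁ xz)) (inj₁ zx) zz = inj₂ (inj₂ (xz , zx))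
  compare xx (inj₁ xz) (inj₁ zx) (inj₁ zz) = inj₁ (record { xx = xx ; xy = xz ; yx = zx ; yy = zz })
  compare {x} {z} xx (inj₁ xz) (inj₁ zx) (inj₂ (inj₁ zz)) = ⊥-elim (¬interleaved-backward {x} {z} xx xz zx zz)
  compare {x} {z} xx (inj₁ xz) (inj₁ zx) (inj₂ (inj₂ eq)) =
    ⊥-elim (antisym _ _ (xz 1 2 1<2) (subst (_⟶ x 1) (eq 0 2 0<2) (zx 0 1 0<1)))
  compare {x} {z} xx (inj₂ (inj₁ xz)) (inj₂ (inj₁ zx)) (inj₁ zz) = ⊥-elim (¬backward-interleaved {x} {z} xx xz zx (inj₁ zz))
  compare {x} {z} xx (inj₂ (inj₁ xz)) (inj₂ (inj₁ zx)) (inj₂ (inj₁ zz)) = ⊥-elim (¬backward-interleaved {x} {z} xx xz zx (inj₂ zz))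
  compare {x} {z} xx (inj₂ (inj₁ xz)) (inj₂ (inj₁ zx)) (inj₂ (inj₂ eq)) =
    ⊥-elim (antisym _ _ (xz 1 2 1<2) (subst (x 1 ⟶_) (eq 0 2 0<2) (zx 0 1 0<1)))

  -- If z were related to x and to y in different ways, z 0, y 0 or x 0 would separate the halves of
  -- a chain.
  compare-chain : ∀ {x y z} → Chain x y → Hom x z → Hom z x → Hom y z → Hom z y → Hom z z →
    (Chain x z × Chain y z) ⊎ (Below x z × Below y z) ⊎ (Above x z × Above y z)
  compare-chain {x} {y} {z} c xz zx yz zy zz = go (compare (xx c) xz zx zz) (compare (yy c) yz zy zz)
    where
    go : Chain x z ⊎ Below x z ⊎ Above x z → Chain y z ⊎ Below y z ⊎ Above y z →
         (Chain x z × Chain y z) ⊎ (Below x z × Below y z) ⊎ (Above x z × Above y z)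
    go (inj₁ a)        (inj₁ b)        = inj₁ (a , b)
    go (inj₂ (inj₁ a)) (inj₂ (inj₁ b)) = inj₂ (inj₁ (a , b))
    go (inj₂ (inj₂ a)) (inj₂ (inj₂ b)) = inj₂ (inj₂ (a , b))
    go (inj₁ a)        (inj₂ (inj₁ b)) = ⊥-elim (split-chain (z 0) c (λ i → proj₂ b _ _ (s≤s z≤n)) (λ i → yx a _ _ (s≤s z≤n)))
    go (inj₂ (inj₁ a)) (inj₁ b)        = ⊥-elim (split-chain (z 0) (swap c) (λ i → proj₂ a _ _ (s≤s z≤n)) (λ i → yx b _ _ (s≤s z≤n)))
    go (inj₂ (inj₁ a)) (inj₂ (inj₂ b)) = ⊥-elim (split-chain (z 0) (swap c) (λ i → proj₂ a _ _ (s≤s z≤n)) (λ i → proj₂ b _ _ (s≤s z≤n)))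
    go (inj₂ (inj₂ a)) (inj₂ (inj₁ b)) = ⊥-elim (split-chain (z 0) c (λ i → proj₂ b _ _ (s≤s z≤n)) (λ i → proj₂ a _ _ (s≤s z≤n)))
    go (inj₁ a)        (inj₂ (inj₂ b)) = ⊥-elim (split-chain (y 0) a (λ i → proj₁ b _ _ (s≤s z≤n)) (λ i → yx c _ _ (s≤s z≤n)))
    go (inj₂ (inj₂ a)) (inj₁ b)        = ⊥-elim (split-chain (x 0) b (λ i → proj₁ a _ _ (s≤s z≤n)) (λ i → xy c _ _ (s≤s z≤n)))

  -- If z lay below or above both sequences, one of the two arcs at z i would be reversed on the
  -- diagonal and give a matching.
  between⇒chain : ∀ {x y z} → Chain x y → Hom x z → Hom z x → Hom y z → Hom z y → Hom z z →
    (∀ i → x i ⟶ z i × z i ⟶ y i) ⊎ (∀ i → y i ⟶ z i × z i ⟶ x i) → Chain x z × Chain y z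
  between⇒chain {x} {y} {z} c xz zx yz zy zz btw with compare-chain c xz zx yz zy zz
  ... | inj₁ r = r
  ... | inj₂ (inj₁ (bx , by)) = ⊥-elim
          ([ (λ h → ¬below-matching {y} {z} (yy c) zz by (proj₂ ∘ h))
           , (λ h → ¬below-matching {x} {z} (xx c) zz bx (proj₂ ∘ h)) ] btw)
  ... | inj₂ (inj₂ (ax , ay)) = ⊥-elim
          ([ (λ h → ¬above-matching {x} {z} (xx c) zz ax (proj₁ ∘ h))
           , (λ h → ¬above-matching {y} {z} (yy c) zz ay (proj₁ ∘ h)) ] btw)

  ¬cycles : ∀ {p q r} → Chain p q → Chain p r → Chain q r → ¬ (∀ i → Cycle (p i) (q i) (r i))
  ¬cycles {p} {q} {r} pq pr qr cyc = ¬coding (cycle-coding A fwd cyc)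
    where
    A : Fin 3 → ℕ → X
    A zero             = p
    A (suc zero)       = q
    A (suc (suc zero)) = r
    fwd : ∀ α β → Fwd (A α) (A β)
    fwd zero             zero             = xx pq
    fwd zero             (suc zero)       = xy pq
    fwd zero             (suc (suc zero)) = xy pr
    fwd (suc zero)       zero             = yx pq
    fwd (suc zero)       (suc zero)       = yy pq
    fwd (suc zero)       (suc (suc zero)) = xy qr
    fwd (suc (suc zero)) zero             = yx pr
    fwd (suc (suc zero)) (suc zero)       = yx qr
    fwd (suc (suc zero)) (suc (suc zero)) = yy pr

  transport : ∀ {x w z} → Chain x w → (∀ i → z i ≡ w i) → Chain x z
  transport {x} {w} {z} c eq = record
    { xx = xx c
    ; xy = λ i j lt → subst (x i ⟶_) (sym (eq j)) (xy c i j lt)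
    ; yx = λ i j lt → subst (_⟶ x j) (sym (eq i)) (yx c i j lt)
    ; yy = λ i j lt → subst₂ _⟶_ (sym (eq i)) (sym (eq j)) (yy c i j lt) }

  module _ (L : Fin 5 → ℕ → X) (hom : ∀ α β → Hom (L α) (L β)) where

    private
      x y p q r : Fin 5
      x = zero
      y = suc zero
      p = suc (suc zero)
      q = suc (suc (suc zero))
      r = suc (suc (suc (suc zero)))

    Within : Fin 5 → Set
    Within z = (∀ i → L z i ≡ L x i) ⊎ (∀ i → L z i ≡ L y i) ⊎ (∀ i → L x i ⟶ L z i × L z i ⟶ L y i)

    -- p and q lie between x and y, so each forms a chain with x, and hence they form one together.
    -- As q → r → p, the sequence r lies between them and joins the chain.
    ¬homogeneous-cycles : Chain (L x) (L y) → Within p → Within q →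
                          ¬ (∀ i → Cycle (L p i) (L q i) (L r i))
    ¬homogeneous-cycles c wp wq cyc = ¬cycles pq (proj₁ r′) (proj₂ r′) cyc
      where
      within : ∀ {z} → Within z → Chain (L x) (L z)
      within (inj₁ eq)        = transport (record { xx = xx c ; xy = xx c ; yx = xx c ; yy = xx c }) eq
      within (inj₂ (inj₁ eq)) = transport c eq
      within (inj₂ (inj₂ b))  = proj₁ (between⇒chain c (hom _ _) (hom _ _) (hom _ _) (hom _ _) (hom _ _) (inj₁ b))
      pq : Chain (L p) (L q)
      pq with compare-chain (within wp) (hom x q) (hom q x) (hom p q) (hom q p) (hom q q)
      ... | inj₁ (_ , pq) = pq
      ... | inj₂ (inj₁ ((_ , b) , _)) = ⊥-elim (antisym _ _ (b 0 1 0<1) (yx (within wq) 0 1 0<1))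
      ... | inj₂ (inj₂ ((b , _) , _)) = ⊥-elim (antisym _ _ (b 0 1 0<1) (xy (within wq) 0 1 0<1))
      r′ : Chain (L p) (L r) × Chain (L q) (L r)
      r′ = between⇒chain pq (hom _ _) (hom _ _) (hom _ _) (hom _ _) (hom _ _)
             (inj₂ λ i → let (_ , qr , rp) = cyc i in qr , rp)

-- Infinitely many classes yield codings

module Classes (em : ExcludedMiddle (lsuc lzero)) (T : Tournament) (¬coding : ¬ (∀ n → Coding T n)) where
  open Classical em
  open Modules em T
  open Arcs T
  open Codings T
  open Homogeneous T ¬coding

  trichotomy : ∀ x y → x ⟶ y ⊎ y ⟶ x ⊎ x ≡ y
  trichotomy x y with dec (x ≡ y)
  ... | yes eq = inj₂ (inj₂ eq)
  ... | no ne  = Sum.map id inj₁ (complete x y ne)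

  abstract
    homogenise : ∀ k (L : Fin k → ℕ → X) → Σ (ℕ → ℕ) λ u → Increasing u × (∀ α β → Hom (L α ∘ u) (L β ∘ u))
    homogenise k L = let (u , u↑ , h) = arcs in u , u↑ , λ α β →
        subst (λ (α , β) → Hom (L α ∘ u) (L β ∘ u)) (FP.remQuot-combine {k} {k} α β) (h (F.combine α β))
      where
      l r : Fin (k * k) → ℕ → X
      l m = L (proj₁ (F.remQuot {k} k m))
      r m = L (proj₂ (F.remQuot {k} k m))
      arcs : Σ (ℕ → ℕ) λ u → Increasing u × (∀ m → Hom (l m ∘ u) (r m ∘ u))
      arcs = ramseyFin (k * k) {λ m i j → l m i ⟶ r m j} {λ m i j → r m j ⟶ l m i} {λ m i j → l m i ≡ r m j}
               (λ m i j _ → trichotomy _ _)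

  module _ (v : ℕ → X) (vv : Fwd v v) (ne : ∀ i j → i < j → ¬ (v i ~ v j)) where

    private
      x y : ℕ → X
      x i = v (double i)
      y i = v (suc (double i))
      witness : ∀ i → Σ X λ p → Σ X λ q → Σ X λ r → Interval (x i) (y i) p × Interval (x i) (y i) q × Cycle p q r
      witness i = ≁⇒cycle (vv _ _ ≤-refl) (ne _ _ ≤-refl)
      p q r : ℕ → X
      p i = proj₁ (witness i)
      q i = proj₁ (proj₂ (witness i))
      r i = proj₁ (proj₂ (proj₂ (witness i)))
      M : Fin 2 → ℕ → X
      M zero       = p
      M (suc zero) = q
      interval : ∀ m i → Interval (x i) (y i) (M m i)
      interval zero       i = proj₁ (proj₂ (proj₂ (proj₂ (witness i))))
      interval (suc zero) i = proj₁ (proj₂ (proj₂ (proj₂ (proj₂ (witness i)))))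
      cycle : ∀ i → Cycle (p i) (q i) (r i)
      cycle i = proj₂ (proj₂ (proj₂ (proj₂ (proj₂ (witness i)))))
      L : Fin 5 → ℕ → X
      L zero                         = x
      L (suc zero)                   = y
      L (suc (suc zero))             = p
      L (suc (suc (suc zero)))       = q
      L (suc (suc (suc (suc zero)))) = r

      Kinds : (ℕ → ℕ) → Fin 2 → Set
      Kinds t m = (∀ i → M m (t i) ≡ x (t i)) ⊎ (∀ i → M m (t i) ≡ y (t i)) ⊎
                  (∀ i → x (t i) ⟶ M m (t i) × M m (t i) ⟶ y (t i))

      abstract
        kinds : Σ (ℕ → ℕ) λ t → Increasing t × (∀ m → Kinds t m)
        -- The colour of a pair depends on its first index only, so Ramsey's theorem acts as a
        -- pigeonhole principle for p and q at once.
        kinds = let (t , t↑ , h) = ramseyFin 2 {λ m i _ → M m i ≡ x i} {λ m i _ → M m i ≡ y i} {λ m i _ → x i ⟶ M m i × M m i ⟶ y i}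
                                     (λ m i _ _ → interval m i)
                in t , t↑ , λ m → Sum.map (λ h i → h i _ ≤-refl) (Sum.map (λ h i → h i _ ≤-refl) (λ h i → h i _ ≤-refl)) (h m)

      homogeneous-subsequence-absurd : ∀ t → Increasing t → (∀ m → Kinds t m) →
        (∀ α β → Hom (L α ∘ t) (L β ∘ t)) → ⊥
      homogeneous-subsequence-absurd t t↑ kind hom =
        ¬homogeneous-cycles (λ α → L α ∘ t) hom chain (kind zero) (kind (suc zero)) (λ i → cycle (t i))
        where
        chain : Chain (x ∘ t) (y ∘ t)
        chain = record
          { xx = λ i j lt → vv _ _ (<-trans (n<1+n _) (double-< (t↑ lt)))
          ; xy = λ i j lt → vv _ _ (<-trans (n<1+n _) (<-trans (double-< (t↑ lt)) (n<1+n _)))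
          ; yx = λ i j lt → vv _ _ (double-< (t↑ lt))
          ; yy = λ i j lt → vv _ _ (<-trans (double-< (t↑ lt)) (n<1+n _)) }

    no-increasing-sequence : ⊥
    no-increasing-sequence = let
        (t , t↑ , kind) = kinds
        (u , u↑ , hom)  = homogenise 5 (λ α → L α ∘ t)
      in homogeneous-subsequence-absurd (t ∘ u) (t↑ ∘ u↑)
           (λ m → Sum.map (_∘ u) (Sum.map (_∘ u) (_∘ u)) (kind m)) hom

-- The dichotomy

¬coding⇒lexSum : (em : ExcludedMiddle (lsuc lzero)) (T : Tournament) → ¬ (∀ n → Coding T n) → LexSumOfAcyclic T
¬coding⇒lexSum em T ¬coding with representatives-or-independent-sequence _~_ ~-sym
  where
  open Classical em
  open Arcs T
... | inj₁ (k , (c , ind) , cover) = Modules.finitely-many-classes⇒lexSum em T c ind cover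
... | inj₂ (s , ind) with Classical.ramsey em {λ i j → _⇒_ T (s i) (s j)} {λ i j → _⇒_ T (s j) (s i)} arcs
  where
  open Arcs T
  arcs : Uniform (λ i j → s i ⟶ s j ⊎ s j ⟶ s i)
  arcs i j lt = complete _ _ λ eq → ind lt (subst (_~ s i) eq ~-refl)
... | t , t↑ , inj₁ f = ⊥-elim (Classes.no-increasing-sequence em T ¬coding (s ∘ t) f
        (λ i j lt r → ind (t↑ lt) (Arcs.~-sym T r)))
-- A decreasing sequence is increasing in the reversed tournament, which has the same equivalence
-- and, up to reversal, the same codings.
... | t , t↑ , inj₂ f = ⊥-elim (Classes.no-increasing-sequence em (flip-tournament T) (λ h → ¬coding (flip-coding ∘ h)) (s ∘ t) f
        (λ i j lt r → ind (t↑ lt) (Arcs.~-sym T (flip-~ T r))))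

theorem1p6 : ExcludedMiddle (lsuc lzero) → (T : Tournament) →
    (PolyBounded T → LexSumOfAcyclic T) × (PolyBounded T ⊎ ExpGrowth T)
theorem1p6 em T with Classical.dec em (∀ n → Coding T n)
... | yes coding = ⊥-elim ∘ Growth.¬polyBounded em T coding , inj₂ (Growth.expGrowth em T coding)
... | no ¬coding = (λ _ → lexSum) , inj₁ (lexSum⇒polyBounded em T lexSum)
  where
  lexSum : LexSumOfAcyclic T
  lexSum = ¬coding⇒lexSum em T ¬coding
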